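{- Let $n\ge 3$, let $P_n$ be the regular $n$-gon with vertices $v_{n,i}=(\cos\frac{2\pi(i-1)}{n},\sin\frac{2\pi(i-1)}{n})$, $1\le i\le n$, and let $\mathcal{T}_n$ be a uniformly random triangulation of $P_n$. For $1\le i\le n-2$ let $\mathcal{A}_{n,i}$ be the number of triangles of $\mathcal{T}_n$ incident with vertex $v_{n,1}$ whose angle at $v_{n,1}$ has size $\frac{\pi i}{n}$. Then for every sequence of integers $0\le k_1,\dots,k_{n-2}\le n-2$ with $\sum_{i=1}^{n-2} i k_i=n-2$, $$\mathbb{P}(\mathcal{A}_{n,1}=k_1,\dots,\mathcal{A}_{n,n-2}=k_{n-2})=\frac{K(2n-K-5)!}{Z_{n,K}\,C_{n-2}\,(n-K-2)!\,(n-2)!}\binom{K}{k_1,\dots,k_{n-2}}C_0^{k_1}C_1^{k_2}\cdots C_{n-3}^{k_{n-2}},$$ where $K:=\sum_{i=1}^{n-2}k_i$ and $$Z_{n,K}:=\sum_{\substack{\sum_{j=1}^{n-2} jp_j=n-2\\ \sum_{j=1}^{n-2}p_j=K\\ 0\le p_j\le n-2}}\binom{K}{p_1,\dots,p_{n-2}}C_0^{p_1}\cdots C_{n-3}^{p_{n-2}}.$$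
   Context: A triangulation of $P_n$ is a set of $n-3$ noncrossing diagonals partitioning $P_n$ into $n-2$ triangles; there are $C_{n-2}$ of them, where $C_k=\frac{1}{k+1}\binom{2k}{k}$ is the $k$-th Catalan number, and $\mathcal{T}_n$ is chosen uniformly among them. The triangle with vertices $v_{n,1},v_{n,j},v_{n,j+i}$ ($2\le j<j+i\le n$) has angle $\frac{\pi i}{n}$ at $v_{n,1}$. $\binom{K}{p_1,\dots,p_{n-2}}=\frac{K!}{p_1!\cdots p_{n-2}!}$ is the multinomial coefficient, and the sum defining $Z_{n,K}$ is over integer tuples $(p_1,\dots,p_{n-2})$. -}

module Defs where

open import Level using (Level)
open import Data.Nat.Base
  using (ℕ; zero; suc; _*_; _∸_; _^_; _/_; _<_; _!; NonZero)
open import Data.Nat.Combinatorics using (_C_)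
open import Data.Nat.ListAction using (product)
import Data.Nat.ListAction as ListAction
open import Data.Nat.ListAction.Properties using (product≢0)
open import Data.Nat.Properties using (_≟_; _<?_; _!≢0)
open import Data.Fin.Base using (Fin; toℕ)
import Data.Fin.Properties as Fin
open import Data.Integer.Base using (+_)
open import Data.Rational.Base using (ℚ)
import Data.Rational.Base as ℚ
open import Data.List.Base as List
  using (List; []; _∷_; _++_; length; map; filter; allFin; cartesianProduct;
         cartesianProductWith; upTo)
import Data.List.Membership.DecPropositional as DecMembership
open import Data.List.Membership.Propositional using (_∈_)
open import Data.List.Relation.Unary.All using (universal)
import Data.List.Relation.Unary.All.Properties as All
open import Data.List.Relation.Unary.AllPairs using (AllPairs; allPairs?)
open import Data.Product.Base using (_×_; _,_)
open import Data.Product.Properties using (≡-dec)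
open import Data.Sum.Base using (_⊎_)
open import Data.Vec.Base as Vec using (Vec; []; _∷_; toList; lookup; tabulate)
open import Relation.Binary.PropositionalEquality.Core using (_≡_)
open import Relation.Nullary.Decidable using (Dec; ¬?; _×-dec_; _⊎-dec_)
open import Relation.Nullary.Negation using (¬_)
open import Relation.Unary using (Pred; Decidable)

private
  variable
    a p : Level
    A : Set a

-- If xs has no repeated entries, each subset of its underlying set occurs
-- exactly once, listed in the order of xs.
sublists : List A → List (List A)
sublists []       = [] ∷ []
sublists (x ∷ xs) = map (x ∷_) (sublists xs) ++ sublists xs

-- Probability of the event E under the uniform distribution on the entries
-- of Ω.
uniform : (Ω : List A) .{{_ : NonZero (length Ω)}} {E : Pred A p} →
          Decidable E → ℚ
uniform Ω E? = + length (filter E? Ω) ℚ./ length Ω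

-- The regular n-gon enters only through the cyclic order of its vertices:
-- the vertex v_{n,i} is the element of Fin n with value i - 1.
module Polygon (n : ℕ) where

  -- A segment {v , w} is the pair with the smaller vertex first.
  Chord : Set
  Chord = Fin n × Fin n

  Side : Chord → Set
  Side (v , w) = suc (toℕ v) ≡ toℕ w ⊎ (toℕ v ≡ 0 × suc (toℕ w) ≡ n)

  side? : Decidable Side
  side? (v , w) =
    (suc (toℕ v) ≟ toℕ w) ⊎-dec ((toℕ v ≟ 0) ×-dec (suc (toℕ w) ≟ n))

  Diagonal : Chord → Set
  Diagonal (v , w) = toℕ v < toℕ w × ¬ Side (v , w)

  diagonal? : Decidable Diagonal
  diagonal? (v , w) = (toℕ v <? toℕ w) ×-dec ¬? (side? (v , w))

  diagonals : List Chord
  diagonals = filter diagonal? (cartesianProduct (allFin n) (allFin n))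

  -- Diagonals of a convex polygon meet in their interiors exactly when their
  -- endpoints interleave.
  Crossing : Chord → Chord → Set
  Crossing (v , w) (x , y) =
    (toℕ v < toℕ x × toℕ x < toℕ w × toℕ w < toℕ y) ⊎
    (toℕ x < toℕ v × toℕ v < toℕ y × toℕ y < toℕ w)

  crossing? : ∀ d e → Dec (Crossing d e)
  crossing? (v , w) (x , y) =
    ((toℕ v <? toℕ x) ×-dec (toℕ x <? toℕ w) ×-dec (toℕ w <? toℕ y)) ⊎-dec
    ((toℕ x <? toℕ v) ×-dec (toℕ v <? toℕ y) ×-dec (toℕ y <? toℕ w))

  Noncrossing : Chord → Chord → Set
  Noncrossing d e = ¬ Crossing d e

  Edge : List Chord → Chord → Set
  Edge T e = Side e ⊎ e ∈ T

  edge? : ∀ T → Decidable (Edge T)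
  edge? T e = side? e ⊎-dec (e ∈? T)
    where open DecMembership (≡-dec Fin._≟_ Fin._≟_) using (_∈?_)

  Triple : Set
  Triple = Fin n × Fin n × Fin n

  -- When the diagonals in T are pairwise noncrossing, no diagonal of T enters
  -- the interior of such a triangle, so these are exactly the triangular
  -- pieces into which T cuts the polygon.
  Triangle : List Chord → Triple → Set
  Triangle T (x , y , z) =
    (toℕ x < toℕ y × toℕ y < toℕ z) ×
    (Edge T (x , y) × Edge T (y , z) × Edge T (x , z))

  triangle? : ∀ T → Decidable (Triangle T)
  triangle? T (x , y , z) =
    ((toℕ x <? toℕ y) ×-dec (toℕ y <? toℕ z)) ×-dec
    (edge? T (x , y) ×-dec edge? T (y , z) ×-dec edge? T (x , z))

  triangles : List Chord → List Triple
  triangles T = filter (triangle? T)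
    (cartesianProduct (allFin n) (cartesianProduct (allFin n) (allFin n)))

  -- n - 3 pairwise noncrossing diagonals cut the polygon into n - 2 pieces,
  -- so the last clause says that all the pieces are triangles.
  IsTriangulation : List Chord → Set
  IsTriangulation T =
    length T ≡ n ∸ 3 × AllPairs Noncrossing T × length (triangles T) ≡ n ∸ 2

  isTriangulation? : Decidable IsTriangulation
  isTriangulation? T =
    (length T ≟ n ∸ 3) ×-dec
    allPairs? (λ d e → ¬? (crossing? d e)) T ×-dec
    (length (triangles T) ≟ n ∸ 2)

  triangulations : List (List Chord)
  triangulations = filter isTriangulation? (sublists diagonals)

  -- The triangle (x , y , z), x < y < z, is incident with v_{n,1} iff x is the
  -- vertex 0, and then its angle there is (z - y)π/n (inscribed angle).
  AngleAtFirst : ℕ → Triple → Set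
  AngleAtFirst i (x , y , z) = toℕ x ≡ 0 × toℕ z ∸ toℕ y ≡ i

  angleAtFirst? : ∀ i → Decidable (AngleAtFirst i)
  angleAtFirst? i (x , y , z) = (toℕ x ≟ 0) ×-dec (toℕ z ∸ toℕ y ≟ i)

  𝒜 : ℕ → List Chord → ℕ
  𝒜 i T = length (filter (angleAtFirst? i) (triangles T))

  -- The entry of k with Fin-index i is k_{i+1}.
  AnglesAre : Vec ℕ (n ∸ 2) → List Chord → Set
  AnglesAre k T = ∀ i → 𝒜 (suc (toℕ i)) T ≡ lookup k i

  anglesAre? : ∀ k → Decidable (AnglesAre k)
  anglesAre? k T = Fin.all? λ i → 𝒜 (suc (toℕ i)) T ≟ lookup k i

-- The division is exact.
catalan : ℕ → ℕ
catalan k = ((2 * k) C k) / suc k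

-- The division is exact when K ≡ Vec.sum p, the only case in which the
-- multinomial coefficient is used.
multinomial : ∀ {m} → ℕ → Vec ℕ m → ℕ
multinomial K p = (K ! / product (map _! (toList p)))
  {{product≢0 (All.map⁺ (universal _!≢0 (toList p)))}}

-- Σ i kᵢ, with i counted from 1.
weightedSum : ∀ {m} → Vec ℕ m → ℕ
weightedSum k = Vec.sum (tabulate λ i → suc (toℕ i) * lookup k i)

-- C₀^k₁ C₁^k₂ ⋯
catalanProduct : ∀ {m} → Vec ℕ m → ℕ
catalanProduct k = product (toList (tabulate λ i → catalan (toℕ i) ^ lookup k i))

-- All vectors of length m with entries between 0 and b inclusive.
boundedVecs : (m b : ℕ) → List (Vec ℕ m)
boundedVecs zero    b = [] ∷ []
boundedVecs (suc m) b =
  cartesianProductWith _∷_ (upTo (suc b)) (boundedVecs m b)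

Z : ℕ → ℕ → ℕ
Z n K = ListAction.sum (map (λ p → multinomial K p * catalanProduct p)
  (filter (λ p → (weightedSum p ≟ n ∸ 2) ×-dec (Vec.sum p ≟ K))
          (boundedVecs (n ∸ 2) (n ∸ 2))))

{-# OPTIONS --safe #-}

-- A triangulation is a binary tree: a node is a triangle, resting on the chord
-- that cuts off its subtree. Conversely, noncrossing forces the triangles of T
-- to have distinct longest edges among the n - 2 available ones, so when there
-- are n - 2 triangles every such edge carries one, and the tree can be read off
-- from the edge {v₁ , vₙ}. The triangles at v₁ form the left spine of the tree,
-- and the angle of such a triangle is π/n times the number of leaves of its right
-- subtree. Hence the triangulations with K triangles at v₁ are the forests of
-- K trees with n - 2 - K nodes: those with prescribed angles are counted by
-- a multinomial times a product of Catalan numbers, and all of them by the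
-- ballot number K (2n - K - 5)! / ((n - K - 2)! (n - 2)!), which is Z n K.
module Submission where

open import Defs
import Algebra.Properties.CommutativeSemigroup as CommutativeSemigroupₚ
open import Data.Nat.Base
  using (ℕ; zero; suc; _+_; _*_; _∸_; _^_; _/_; _!; _≤_; _<_; z≤n; s≤s; NonZero)
open import Data.Nat.Combinatorics using (_C_; k![n∸k]!∣n!; nCk≡n!/k![n-k]!)
open import Data.Nat.DivMod using (m*n/n≡m; m/n*n≡m)
import Data.Nat.ListAction as ListAction
open import Data.Nat.ListAction using (product)
open import Data.Nat.ListAction.Properties using (product≢0)
open import Data.Nat.Properties
open import Data.Nat.Tactic.RingSolver using (solve-∀)
open import Data.Fin.Base using (Fin; zero; suc; toℕ; fromℕ<)
import Data.Fin.Properties as Fin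
open import Data.Integer.Base using (+_)
import Data.Integer.Base as ℤ
import Data.Integer.Properties as ℤ
import Data.Rational.Base as ℚ
import Data.Rational.Properties as ℚ
import Data.Rational.Unnormalised.Base as ℚᵘ
import Data.Rational.Unnormalised.Properties as ℚᵘ
open import Data.List.Base
  using (List; []; _∷_; _++_; length; map; filter; concatMap; allFin;
         cartesianProduct; cartesianProductWith)
open import Data.List.Properties
  using (length-++; length-map; map-∘; ++-identityʳ; filter-++; filter-none;
         filter-accept; filter-reject)
open import Data.List.Membership.Propositional using (_∈_; find; lose)
open import Data.List.Membership.Propositional.Properties
open import Data.List.Relation.Binary.Subset.Propositional using (_⊆_)
open import Data.List.Relation.Unary.Any using (here; there)
import Data.List.Relation.Unary.All as ListAll
open ListAll using ([]; _∷_)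
import Data.List.Relation.Unary.All.Properties as ListAllₚ
open import Data.List.Relation.Unary.AllPairs using (AllPairs; []; _∷_)
import Data.List.Relation.Unary.AllPairs.Properties as AllPairs
open import Data.List.Relation.Unary.Unique.Propositional using (Unique)
import Data.List.Relation.Unary.Unique.Propositional.Properties as Unique
open import Data.Product.Base using (_×_; _,_; proj₁; proj₂; ∃-syntax; Σ-syntax)
open import Data.Product.Properties using (≡-dec)
open import Data.Sum.Base using (_⊎_; inj₁; inj₂)
open import Data.Vec.Base as Vec
  using (Vec; []; _∷_; lookup; replicate; sum; tabulate; toList)
open import Data.Vec.Properties
  using (∷-injectiveˡ; ∷-injectiveʳ; lookup-replicate; tabulate∘lookup; tabulate-cong)
open import Data.Vec.Relation.Unary.All using (All)
open import Function.Base using (_∘_; case_of_)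
open import Level using (Level)
open import Relation.Binary.Definitions using (DecidableEquality; tri<; tri≈; tri>)
open import Relation.Binary.PropositionalEquality
open import Relation.Nullary using (¬_; Dec; yes; no; contradiction; _×-dec_)
open import Relation.Unary using (Pred; Decidable)

open CommutativeSemigroupₚ +-commutativeSemigroup using ()
  renaming (x∙yz≈y∙xz to x+[y+z]≡y+[x+z])
open CommutativeSemigroupₚ *-commutativeSemigroup using ()
  renaming (x∙yz≈y∙xz to x*[y*z]≡y*[x*z])

-- Every bijection is established as two inclusions between repetition-free lists, which then have
-- equal length. The obstacle is that a triangulation is given only by noncrossing and by two
-- counts, with no way to cut a polygon into smaller ones; existence statements therefore come from
-- counting. Trees are drawn on natural numbers from an arbitrary start, so that subpolygons need no
-- renumbering, and only the whole polygon is translated to `Fin n`. The list `withProfile K k`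
-- serves twice: its image under `encode ∘ fromSpine` is the event, and its union over all
-- admissible vectors is the list of forests whose length is `Z n K`. The factor K (2n - K - 5)! /
-- (Z (n - K - 2)! (n - 2)!) thus equals 1, and the probability is the multinomial term over
-- `catalan (n ∸ 2)`. The ballot formula is kept in multiplied-out form, so that division enters
-- only through `catalan`, `multinomial` and the final fractions.

private
  variable
    a b p : Level
    A : Set a
    B : Set b
    m K : ℕ

-- Repetition-free lists: pigeonhole and sublists.

unique-⊆-length : {xs ys : List A} → Unique xs → xs ⊆ ys → length xs ≤ length ys
unique-⊆-length {xs = []} u s = z≤n
unique-⊆-length {xs = x ∷ xs} (x∉ ∷ u) s with us , vs , refl ← ∈-∃++ (s (here refl)) =
  begin
    suc (length xs)               ≤⟨ s≤s (unique-⊆-length u s′) ⟩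
    suc (length (us ++ vs))       ≡⟨ cong suc (length-++ us) ⟩
    suc (length us + length vs)   ≡⟨ +-suc (length us) (length vs) ⟨
    length us + suc (length vs)   ≡⟨ length-++ us ⟨
    length (us ++ x ∷ vs)         ∎
  where
  open ≤-Reasoning
  s′ : xs ⊆ us ++ vs
  s′ y∈ with ∈-++⁻ us (s (there y∈))
  ... | inj₁ q            = ∈-++⁺ˡ q
  ... | inj₂ (there q)    = ∈-++⁺ʳ us q
  ... | inj₂ (here refl)  = contradiction refl (ListAll.lookup x∉ y∈)

unique-set-length : {xs ys : List A} → Unique xs → Unique ys →
                    xs ⊆ ys → ys ⊆ xs → length xs ≡ length ys
unique-set-length u v s t = ≤-antisym (unique-⊆-length u s) (unique-⊆-length v t)

-- An entry of `ys` missing from `xs` could be put in front of `xs`, giving a repetition-free list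
-- too long to fit into `ys`. This is how equal counts yield existence.
unique-⊆-full : DecidableEquality A → {xs ys : List A} → Unique xs → xs ⊆ ys →
                length ys ≤ length xs → ys ⊆ xs
unique-⊆-full _≟A_ {xs} {ys} u s le {y} y∈ with y ∈? xs
  where open import Data.List.Membership.DecPropositional _≟A_
... | yes q = q
... | no y∉ = contradiction
  (unique-⊆-length (ListAll.tabulate (λ z∈ eq → y∉ (subst (_∈ xs) (sym eq) z∈)) ∷ u) s′)
  (≤⇒≯ le)
  where
  s′ : y ∷ xs ⊆ ys
  s′ (here refl) = y∈
  s′ (there q)   = s q

allPairs-∈ : {R : A → A → Set p} {xs : List A} →
             (∀ {x y} → x ∈ xs → y ∈ xs → R x y) → AllPairs R xs
allPairs-∈ {xs = []}     f = []
allPairs-∈ {xs = x ∷ xs} f =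
  ListAll.tabulate (λ y∈ → f (here refl) (there y∈)) ∷
  allPairs-∈ (λ x∈ y∈ → f (there x∈) (there y∈))

unique-map⁺-∈ : {f : A → B} {xs : List A} →
                (∀ {x y} → x ∈ xs → y ∈ xs → f x ≡ f y → x ≡ y) →
                Unique xs → Unique (map f xs)
unique-map⁺-∈ {xs = []} inj [] = []
unique-map⁺-∈ {f = f} {xs = x ∷ xs} inj (x∉ ∷ u) =
  ListAll.tabulate (λ z∈ eq → helper z∈ eq) ∷
  unique-map⁺-∈ (λ p q → inj (there p) (there q)) u
  where
  helper : ∀ {z} → z ∈ map f xs → f x ≡ z → _
  helper z∈ refl with y , y∈ , eq ← ∈-map⁻ f z∈ =
    ListAll.lookup x∉ y∈ (inj (here refl) (there y∈) eq)

sublists-⊆ : ∀ {xs : List A} {ys} → ys ∈ sublists xs → ys ⊆ xs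
sublists-⊆ {xs = []} (here refl) ()
sublists-⊆ {xs = x ∷ xs} q y∈ with ∈-++⁻ (map (x ∷_) (sublists xs)) q
... | inj₂ r = there (sublists-⊆ r y∈)
... | inj₁ r with _ , zs∈ , refl ← ∈-map⁻ (x ∷_) r with y∈
...   | here eq  = here eq
...   | there y∈ = there (sublists-⊆ zs∈ y∈)

sublists-unique : {xs : List A} → Unique xs → Unique (sublists xs)
sublists-unique {xs = []} [] = [] ∷ []
sublists-unique {xs = x ∷ xs} (x∉ ∷ u) =
  Unique.++⁺ (Unique.map⁺ (λ { refl → refl }) (sublists-unique u)) (sublists-unique u)
    λ { (p , q) → case ∈-map⁻ (x ∷_) p of λ
      { (_ , _ , refl) → ListAll.lookup x∉ (sublists-⊆ q (here refl)) refl } }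

module _ {P : Pred A p} (P? : Decidable P) where

  filter-∈-sublists : ∀ xs → filter P? xs ∈ sublists xs
  filter-∈-sublists [] = here refl
  filter-∈-sublists (x ∷ xs) with P? x
  ... | yes _ = ∈-++⁺ˡ (∈-map⁺ (x ∷_) (filter-∈-sublists xs))
  ... | no  _ = ∈-++⁺ʳ (map (x ∷_) (sublists xs)) (filter-∈-sublists xs)

  -- The order of a sublist is inherited, so its members determine it. Equality of a triangulation
  -- with `encode t`, as lists, is thereby reduced to equality as sets of diagonals.
  sublist-filter : ∀ {xs ys} → Unique xs → ys ∈ sublists xs →
                   (∀ {x} → x ∈ ys → P x) → (∀ {x} → x ∈ xs → P x → x ∈ ys) →
                   ys ≡ filter P? xs
  sublist-filter {[]} u (here refl) f g = refl
  sublist-filter {x ∷ xs} (x∉ ∷ u) q f g with ∈-++⁻ (map (x ∷_) (sublists xs)) q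
  ... | inj₂ r = trans
    (sublist-filter u r f (λ y∈ → g (there y∈)))
    (sym (filter-reject P? (λ px → ListAll.lookup x∉ (sublists-⊆ r (g (here refl) px)) refl)))
  ... | inj₁ r with zs , zs∈ , refl ← ∈-map⁻ (x ∷_) r = trans
    (cong (x ∷_) (sublist-filter u zs∈ (f ∘ there) g′))
    (sym (filter-accept P? (f (here refl))))
    where
    g′ : ∀ {y} → y ∈ xs → P y → y ∈ zs
    g′ y∈ py with g (there y∈) py
    ... | here refl = contradiction refl (ListAll.lookup x∉ y∈)
    ... | there r   = r

-- Triangulations as binary trees

data Tree : Set where
  leaf : Tree
  node : Tree → Tree → Tree

size : Tree → ℕ
size leaf       = 0
size (node l r) = suc (size l + size r)

-- A tree t drawn from the vertex a triangulates the polygon with vertices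
-- a, a + 1, …, end a t; the triangle of a node rests on the chord cut off by
-- that node.
end : ℕ → Tree → ℕ
end a leaf       = suc a
end a (node l r) = end (end a l) r

triples : ℕ → Tree → List (ℕ × ℕ × ℕ)
triples a leaf       = []
triples a (node l r) =
  (a , end a l , end (end a l) r) ∷ triples a l ++ triples (end a l) r

outer : ℕ × ℕ × ℕ → ℕ × ℕ
outer (x , y , z) = x , z

chords : ℕ → Tree → List (ℕ × ℕ)
chords a t = map outer (triples a t)

-- The chord from `a` to `end a t` below the root already belongs to `chords a t`, so the only sides
-- to be added are the unit steps. For the whole polygon that root chord is the side joining the
-- first and last vertices.
InEdge : ℕ → Tree → ℕ → ℕ → Set
InEdge a t x z = z ≡ suc x ⊎ (x , z) ∈ chords a t

end≡ : ∀ a t → end a t ≡ suc (a + size t)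
end≡ a leaf = cong suc (sym (+-identityʳ a))
end≡ a (node l r) = begin
  end (end a l) r                  ≡⟨ end≡ (end a l) r ⟩
  suc (end a l + size r)           ≡⟨ cong (λ e → suc (e + size r)) (end≡ a l) ⟩
  suc (suc (a + size l + size r))  ≡⟨ cong (λ u → suc (suc u)) (+-assoc a (size l) (size r)) ⟩
  suc (suc (a + (size l + size r))) ≡⟨ cong suc (+-suc a _) ⟨
  suc (a + suc (size l + size r))  ∎
  where open ≡-Reasoning

a<end : ∀ a t → a < end a t
a<end a t = subst (a <_) (sym (end≡ a t)) (s≤s (m≤m+n a (size t)))

length-triples : ∀ a t → length (triples a t) ≡ size t
length-triples a leaf       = refl
length-triples a (node l r) = cong suc (trans (length-++ (triples a l))
  (cong₂ _+_ (length-triples a l) (length-triples (end a l) r)))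

∈-chords⁻ : ∀ {x z} a t → (x , z) ∈ chords a t → ∃[ y ] (x , y , z) ∈ triples a t
∈-chords⁻ a t q with (_ , y , _) , r , refl ← ∈-map⁻ outer q = y , r

∈-chords⁺ : ∀ {x y z} a t → (x , y , z) ∈ triples a t → (x , z) ∈ chords a t
∈-chords⁺ a t = ∈-map⁺ outer

data NodeView (a : ℕ) (l r : Tree) (τ : ℕ × ℕ × ℕ) : Set where
  root  : τ ≡ (a , end a l , end (end a l) r) → NodeView a l r τ
  left  : τ ∈ triples a l → NodeView a l r τ
  right : τ ∈ triples (end a l) r → NodeView a l r τ

nodeView : ∀ {a l r τ} → τ ∈ triples a (node l r) → NodeView a l r τ
nodeView (here eq) = root eq
nodeView {a} {l} (there q) with ∈-++⁻ (triples a l) q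
... | inj₁ q = left q
... | inj₂ q = right q

∈-left : ∀ {a l τ} r → τ ∈ triples a l → τ ∈ triples a (node l r)
∈-left r q = there (∈-++⁺ˡ q)

∈-right : ∀ {a r τ} l → τ ∈ triples (end a l) r → τ ∈ triples a (node l r)
∈-right {a} l q = there (∈-++⁺ʳ (triples a l) q)

record Bounds (a x y z b : ℕ) : Set where
  constructor bounds
  field
    a≤x : a ≤ x
    x<y : x < y
    y<z : y < z
    z≤b : z ≤ b
  x<z : x < z
  x<z = <-trans x<y y<z

triple-bounds : ∀ {a x y z} t → (x , y , z) ∈ triples a t → Bounds a x y z (end a t)
triple-bounds {a} (node l r) q with nodeView {a} {l} {r} q
... | root refl = bounds ≤-refl (a<end a l) (a<end (end a l) r) ≤-refl
... | left q  = let bounds p1 p2 p3 p4 = triple-bounds l q in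
                bounds p1 p2 p3 (≤-trans p4 (<⇒≤ (a<end (end a l) r)))
... | right q = let bounds p1 p2 p3 p4 = triple-bounds r q in
                bounds (≤-trans (<⇒≤ (a<end a l)) p1) p2 p3 p4

root-edge : ∀ a t → InEdge a t a (end a t)
root-edge a leaf       = inj₁ refl
root-edge a (node l r) = inj₂ (here refl)

edge-map : ∀ {a b x z} t t′ → (∀ {τ} → τ ∈ triples a t → τ ∈ triples b t′) →
           InEdge a t x z → InEdge b t′ x z
edge-map t t′ f (inj₁ eq) = inj₁ eq
edge-map {a} {b} t t′ f (inj₂ q) = inj₂ (∈-chords⁺ b t′ (f (proj₂ (∈-chords⁻ a t q))))

triple-edges : ∀ {a x y z} t → (x , y , z) ∈ triples a t →
               InEdge a t x y × InEdge a t y z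
triple-edges {a} t@(node l r) q with nodeView {a} {l} {r} q
... | root refl = edge-map l t (∈-left r) (root-edge a l) ,
                edge-map r t (∈-right l) (root-edge (end a l) r)
... | left q  = let e , f = triple-edges l q in
                edge-map l t (∈-left r) e , edge-map l t (∈-left r) f
... | right q = let e , f = triple-edges r q in
                edge-map r t (∈-right l) e , edge-map r t (∈-right l) f

-- The root interval contains all the others, and the intervals of the two subtrees share only the
-- vertex `end a l`; a crossing could only occur within one subtree.
triples-noncrossing : ∀ {a x y z x′ y′ z′} t →
  (x , y , z) ∈ triples a t → (x′ , y′ , z′) ∈ triples a t →
  x < x′ → x′ < z → ¬ z < z′
triples-noncrossing {a} t@(node l r) p q x<x′ x′<z z<z′
  with nodeView {a} {l} {r} p | nodeView {a} {l} {r} q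
... | root refl | _ = <⇒≱ z<z′ (Bounds.z≤b (triple-bounds t q))
... | left p | root refl = <⇒≱ x<x′ (Bounds.a≤x (triple-bounds l p))
... | right p | root refl = <⇒≱ x<x′ (Bounds.a≤x (triple-bounds t (∈-right l p)))
... | left p | left q = triples-noncrossing l p q x<x′ x′<z z<z′
... | right p | right q = triples-noncrossing r p q x<x′ x′<z z<z′
... | left p | right q = <⇒≱ x′<z
  (≤-trans (Bounds.z≤b (triple-bounds l p)) (Bounds.a≤x (triple-bounds r q)))
... | right p | left q = <⇒≱ (<-trans (<-trans x<x′ x′<z) z<z′)
  (≤-trans (Bounds.z≤b (triple-bounds l q)) (Bounds.a≤x (triple-bounds r p)))

chords-noncrossing : ∀ {a x z x′ z′} t →
  (x , z) ∈ chords a t → (x′ , z′) ∈ chords a t →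
  x < x′ → x′ < z → ¬ z < z′
chords-noncrossing {a} t p q =
  triples-noncrossing t (proj₂ (∈-chords⁻ a t p)) (proj₂ (∈-chords⁻ a t q))

long-edge : ∀ {a t x y z} → x < y → y < z → InEdge a t x z → (x , z) ∈ chords a t
long-edge x<y y<z (inj₁ refl) = contradiction (≤-trans (s≤s x<y) y<z) 1+n≰n
long-edge x<y y<z (inj₂ q)    = q

-- The chord from `x` to `z` carries some triple of the tree, with apex `c`. If `y` differed from
-- `c`, an edge at `y` would cross an edge at `c`.
triangle⇒triple : ∀ {a x y z} t → x < y → y < z →
  InEdge a t x y → InEdge a t y z → InEdge a t x z → (x , y , z) ∈ triples a t
triangle⇒triple {a} {x} {y} {z} t x<y y<z xy yz xz
  with c , q ← ∈-chords⁻ a t (long-edge x<y y<z xz)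
  with <-cmp y c | triple-edges t q | triple-bounds t q
... | tri≈ _ refl _ | _       | _ = q
... | tri< y<c _ _  | xc , cz | bnd = contradiction (Bounds.y<z bnd)
  (chords-noncrossing t (long-edge x<y y<c xc) (long-edge y<c (Bounds.y<z bnd) yz) x<y y<c)
... | tri> _ _ c<y  | xc , cz | bnd = contradiction y<z
  (chords-noncrossing t (long-edge (Bounds.x<y bnd) c<y xy) (long-edge c<y y<z cz)
    (Bounds.x<y bnd) c<y)

-- The root interval is strictly longer than every interval below it, and intervals on different
-- sides of the apex have at most an endpoint in common.
chords-unique : ∀ a t → Unique (chords a t)
chords-unique a leaf = []
chords-unique a (node l r) = AllPairs.map⁺ {xs = triples a (node l r)} (
  ListAll.tabulate (λ {τ} → root-new {τ}) ∷
  AllPairs.++⁺ (AllPairs.map⁻ (chords-unique a l)) (AllPairs.map⁻ (chords-unique (end a l) r))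
    (ListAll.tabulate λ {τ} p → ListAll.tabulate λ {τ′} q → separate {τ} {τ′} p q))
  where
  root-new : ∀ {τ} → τ ∈ triples a l ++ triples (end a l) r →
             ¬ (a , end (end a l) r) ≡ outer τ
  root-new q refl with ∈-++⁻ (triples a l) q
  ... | inj₁ q = <⇒≱ (a<end (end a l) r) (Bounds.z≤b (triple-bounds l q))
  ... | inj₂ q = <⇒≱ (a<end a l) (Bounds.a≤x (triple-bounds r q))
  separate : ∀ {τ τ′} → τ ∈ triples a l → τ′ ∈ triples (end a l) r → ¬ outer τ ≡ outer τ′
  separate p q refl = <⇒≱ (Bounds.x<z (triple-bounds l p))
    (≤-trans (Bounds.z≤b (triple-bounds l p)) (Bounds.a≤x (triple-bounds r q)))

triples-unique : ∀ a t → Unique (triples a t)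
triples-unique a t = Unique.map⁻ (chords-unique a t)

-- Equal sizes give equal end vertices. Only the root of `t′` spans from `a` to that end, so the two
-- apexes agree, and the intervals then sort the remaining triples into the left and right subtrees.
triples-injective : ∀ {a} t t′ → size t ≡ size t′ →
  (∀ {τ} → τ ∈ triples a t → τ ∈ triples a t′) → t ≡ t′
triples-injective leaf leaf _ _ = refl
triples-injective {a} (node l r) (node l′ r′) eq f =
  case root-apex (f (here refl)) of λ apex →
  cong₂ node (triples-injective l l′ (size-l apex) (into-l apex))
             (triples-injective r r′ (size-r apex) (into-r apex))
  where
  c  = end a l
  c′ = end a l′
  end-eq : end c r ≡ end c′ r′
  end-eq = trans (end≡ a (node l r))
    (trans (cong (λ s → suc (a + s)) eq) (sym (end≡ a (node l′ r′))))
  root-apex : (a , c , end c r) ∈ triples a (node l′ r′) → c ≡ c′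
  root-apex q with nodeView {a} {l′} {r′} q
  ... | left q = contradiction (≤-trans (a<end c′ r′) (≤-reflexive (sym end-eq)))
                               (≤⇒≯ (Bounds.z≤b (triple-bounds l′ q)))
  ... | right q = contradiction (a<end a l′) (≤⇒≯ (Bounds.a≤x (triple-bounds r′ q)))
  ... | root eq = cong (proj₁ ∘ proj₂) eq
  size-l : c ≡ c′ → size l ≡ size l′
  size-l apex = +-cancelˡ-≡ (suc a) _ _ (trans (sym (end≡ a l)) (trans apex (end≡ a l′)))
  size-r : c ≡ c′ → size r ≡ size r′
  size-r apex = +-cancelˡ-≡ (size l) _ _
    (suc-injective (trans eq (cong (λ s → suc (s + size r′)) (sym (size-l apex)))))
  into-l : c ≡ c′ → ∀ {τ} → τ ∈ triples a l → τ ∈ triples a l′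
  into-l apex p with nodeView {a} {l′} {r′} (f (∈-left r p))
  ... | left q    = q
  ... | right q   = contradiction
    (≤-trans (Bounds.z≤b (triple-bounds l p)) (≤-reflexive apex))
    (<⇒≱ (≤-<-trans (Bounds.a≤x (triple-bounds r′ q)) (Bounds.x<z (triple-bounds l p))))
  ... | root refl = contradiction (Bounds.z≤b (triple-bounds l p))
    (<⇒≱ (subst (_< end c′ r′) (sym apex) (a<end c′ r′)))
  into-r : c ≡ c′ → ∀ {τ} → τ ∈ triples c r → τ ∈ triples c r′
  into-r apex p with nodeView {a} {l′} {r′} (f (∈-right l p))
  ... | right q   = subst (λ e → _ ∈ triples e r′) (sym apex) q
  ... | left q    = contradiction (Bounds.z≤b (triple-bounds l′ q))
    (<⇒≱ (≤-<-trans (≤-trans (≤-reflexive (sym apex)) (Bounds.a≤x (triple-bounds r p)))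
                    (Bounds.x<z (triple-bounds r p))))
  ... | root refl = contradiction (Bounds.a≤x (triple-bounds r p)) (<⇒≱ (a<end a l))

-- From trees to triangulations, with `m` = n - 3 diagonals and `suc m` triangles.

module Encoding {n m : ℕ} (n≡3+m : n ≡ 3 + m) where

  open Polygon n
  open import Data.List.Membership.DecPropositional (≡-dec _≟_ _≟_) using (_∈?_)

  φ : Chord → ℕ × ℕ
  φ (v , w) = toℕ v , toℕ w

  ψ : Triple → ℕ × ℕ × ℕ
  ψ (x , y , z) = toℕ x , toℕ y , toℕ z

  φ-injective : ∀ {d e} → φ d ≡ φ e → d ≡ e
  φ-injective eq = cong₂ _,_ (Fin.toℕ-injective (cong proj₁ eq))
                             (Fin.toℕ-injective (cong proj₂ eq))

  ψ-injective : ∀ {σ τ} → ψ σ ≡ ψ τ → σ ≡ τ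
  ψ-injective eq = cong₂ _,_ (Fin.toℕ-injective (cong proj₁ eq)) (φ-injective (cong proj₂ eq))

  decode : ∀ {x y z} → x < y → y < z → z < n → ∃[ τ ] ψ τ ≡ (x , y , z)
  decode x<y y<z z<n =
    (fromℕ< x<n , fromℕ< y<n , fromℕ< z<n) ,
    cong₂ _,_ (Fin.toℕ-fromℕ< x<n) (cong₂ _,_ (Fin.toℕ-fromℕ< y<n) (Fin.toℕ-fromℕ< z<n))
    where
    y<n = <-trans y<z z<n
    x<n = <-trans x<y y<n

  -- The side on which the root triangle rests; its last vertex is n - 1 = 2 + m. Being a side it
  -- lies in no triangulation, so it is adjoined whenever longest edges of triangles are counted.
  base : Chord
  base = fromℕ< 0<n , fromℕ< 2+m<n
    where
    2+m<n : 2 + m < n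
    2+m<n = ≤-reflexive (sym n≡3+m)
    0<n : 0 < n
    0<n = ≤-trans (s≤s z≤n) 2+m<n

  φ-base : φ base ≡ (0 , 2 + m)
  φ-base = cong₂ _,_ (Fin.toℕ-fromℕ< _) (Fin.toℕ-fromℕ< _)

  last-vertex : ∀ {w} → suc w ≡ n → w ≡ 2 + m
  last-vertex eq = suc-injective (trans eq n≡3+m)

  diagonals-unique : Unique diagonals
  diagonals-unique = Unique.filter⁺ diagonal?
    (Unique.cartesianProduct⁺ (Unique.allFin⁺ n) (Unique.allFin⁺ n))

  ∈-diagonals : ∀ {e} → Diagonal e → e ∈ diagonals
  ∈-diagonals = ∈-filter⁺ diagonal? (∈-cartesianProduct⁺ (∈-allFin _) (∈-allFin _))

  ∈-diagonals⁻ : ∀ {e} → e ∈ diagonals → Diagonal e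
  ∈-diagonals⁻ q = proj₂ (∈-filter⁻ diagonal? {xs = cartesianProduct (allFin n) (allFin n)} q)

  triangles-unique : ∀ T → Unique (triangles T)
  triangles-unique T = Unique.filter⁺ (triangle? T)
    (Unique.cartesianProduct⁺ (Unique.allFin⁺ n)
      (Unique.cartesianProduct⁺ (Unique.allFin⁺ n) (Unique.allFin⁺ n)))

  ∈-triangles : ∀ {T τ} → Triangle T τ → τ ∈ triangles T
  ∈-triangles {T} = ∈-filter⁺ (triangle? T)
    (∈-cartesianProduct⁺ (∈-allFin _) (∈-cartesianProduct⁺ (∈-allFin _) (∈-allFin _)))

  ∈-triangles⁻ : ∀ {T τ} → τ ∈ triangles T → Triangle T τ
  ∈-triangles⁻ {T} q = proj₂ (∈-filter⁻ (triangle? T)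
    {xs = cartesianProduct (allFin n) (cartesianProduct (allFin n) (allFin n))} q)

  inner? : (t : Tree) → Decidable (λ e → φ e ∈ chords 0 t)
  inner? t e = φ e ∈? chords 0 t

  -- Filtering `diagonals`, rather than translating the chords of the tree one by one, makes the
  -- result an entry of `sublists diagonals` in the right order, and drops the root chord, which is
  -- a side.
  encode : Tree → List Chord
  encode t = filter (inner? t) diagonals

  ∈-encode⁻ : ∀ {t e} → e ∈ encode t → Diagonal e × φ e ∈ chords 0 t
  ∈-encode⁻ {t} q with p , r ← ∈-filter⁻ (inner? t) {xs = diagonals} q = ∈-diagonals⁻ p , r

  module _ {t : Tree} (size≡ : size t ≡ suc m) where

    end≡n-1 : end 0 t ≡ 2 + m
    end≡n-1 = trans (end≡ 0 t) (cong suc size≡)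

    base∈chords : (0 , 2 + m) ∈ chords 0 t
    base∈chords with root-edge 0 t
    ... | inj₁ eq = contradiction (trans (sym eq) end≡n-1) λ ()
    ... | inj₂ q  = subst (λ e → (0 , e) ∈ chords 0 t) end≡n-1 q

    encode-edge⁻ : ∀ {v w} → Edge (encode t) (v , w) → InEdge 0 t (toℕ v) (toℕ w)
    encode-edge⁻ (inj₁ (inj₁ eq)) = inj₁ (sym eq)
    encode-edge⁻ {v} {w} (inj₁ (inj₂ (v≡0 , 1+w≡n))) =
      inj₂ (subst₂ (λ x z → (x , z) ∈ chords 0 t) (sym v≡0) (sym (last-vertex 1+w≡n)) base∈chords)
    encode-edge⁻ (inj₂ q) = inj₂ (proj₂ (∈-encode⁻ q))

    encode-edge⁺ : ∀ {v w} → toℕ v < toℕ w → InEdge 0 t (toℕ v) (toℕ w) → Edge (encode t) (v , w)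
    encode-edge⁺ v<w (inj₁ eq) = inj₁ (inj₁ (sym eq))
    encode-edge⁺ {v} {w} v<w (inj₂ q) with side? (v , w)
    ... | yes s = inj₁ s
    ... | no ¬s = inj₂ (∈-filter⁺ (inner? t) (∈-diagonals (v<w , ¬s)) q)

    triangle⇒∈triples : ∀ {τ} → τ ∈ triangles (encode t) → ψ τ ∈ triples 0 t
    triangle⇒∈triples {x , y , z} q
      with (x<y , y<z) , xy , yz , xz ← ∈-triangles⁻ {encode t} q =
      triangle⇒triple t x<y y<z (encode-edge⁻ xy) (encode-edge⁻ yz) (encode-edge⁻ xz)

    ∈triples⇒triangle : ∀ {τ} → τ ∈ triples 0 t → ∃[ σ ] σ ∈ triangles (encode t) × τ ≡ ψ σ
    ∈triples⇒triangle q
      with bounds _ x<y y<z z≤b ← triple-bounds t q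
      with σ@(x , y , z) , refl ←
        decode x<y y<z (subst (_ <_) (trans (cong suc end≡n-1) (sym n≡3+m)) (s≤s z≤b))
      with xy , yz ← triple-edges t q =
      σ , ∈-triangles ((x<y , y<z) , encode-edge⁺ x<y xy , encode-edge⁺ y<z yz ,
            encode-edge⁺ (<-trans x<y y<z) (inj₂ (∈-chords⁺ 0 t q))) , refl

    length-filter-triangles : ∀ {p} {Q : Pred (ℕ × ℕ × ℕ) p} (Q? : Decidable Q) →
      length (filter (Q? ∘ ψ) (triangles (encode t))) ≡ length (filter Q? (triples 0 t))
    length-filter-triangles Q? = trans (sym (length-map ψ (filter (Q? ∘ ψ) (triangles (encode t)))))
      (unique-set-length
      (Unique.map⁺ ψ-injective (Unique.filter⁺ (Q? ∘ ψ) (triangles-unique (encode t))))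
      (Unique.filter⁺ Q? (triples-unique 0 t))
      into onto)
      where
      into : map ψ (filter (Q? ∘ ψ) (triangles (encode t))) ⊆ filter Q? (triples 0 t)
      into q with σ , r , refl ← ∈-map⁻ ψ q
             with p , s ← ∈-filter⁻ (Q? ∘ ψ) {xs = triangles (encode t)} r =
        ∈-filter⁺ Q? (triangle⇒∈triples p) s
      onto : filter Q? (triples 0 t) ⊆ map ψ (filter (Q? ∘ ψ) (triangles (encode t)))
      onto q with p , s ← ∈-filter⁻ Q? {xs = triples 0 t} q
             with σ , r , refl ← ∈triples⇒triangle p =
        ∈-map⁺ ψ (∈-filter⁺ (Q? ∘ ψ) r s)

    length-triangles : length (triangles (encode t)) ≡ suc m
    length-triangles = trans (sym (length-map ψ (triangles (encode t)))) (trans (unique-set-length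
      (Unique.map⁺ ψ-injective (triangles-unique (encode t))) (triples-unique 0 t) into onto)
      (trans (length-triples 0 t) size≡))
      where
      into : map ψ (triangles (encode t)) ⊆ triples 0 t
      into q with σ , r , refl ← ∈-map⁻ ψ q = triangle⇒∈triples r
      onto : triples 0 t ⊆ map ψ (triangles (encode t))
      onto p with σ , r , refl ← ∈triples⇒triangle p = ∈-map⁺ ψ r

    -- The `suc m` chords of the tree are the encoded diagonals together with the side from 0 to 2 +
    -- m.
    length-encode : length (encode t) ≡ m
    length-encode = suc-injective (begin
      suc (length (encode t))         ≡⟨ cong suc (length-map φ (encode t)) ⟨
      length ((0 , 2 + m) ∷ map φ (encode t))
        ≡⟨ unique-set-length (ListAll.tabulate base∉ ∷ Unique.map⁺ φ-injective encode-unique)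
             (chords-unique 0 t) into onto ⟩
      length (chords 0 t)             ≡⟨ length-map outer (triples 0 t) ⟩
      length (triples 0 t)            ≡⟨ length-triples 0 t ⟩
      size t                          ≡⟨ size≡ ⟩
      suc m                           ∎)
      where
      open ≡-Reasoning
      encode-unique : Unique (encode t)
      encode-unique = Unique.filter⁺ (inner? t) diagonals-unique
      base∉ : ∀ {c} → c ∈ map φ (encode t) → (0 , 2 + m) ≢ c
      base∉ q eq with e , r , refl ← ∈-map⁻ φ q =
        proj₂ (proj₁ (∈-encode⁻ r))
              (inj₂ (sym (cong proj₁ eq) , trans (cong suc (sym (cong proj₂ eq))) (sym n≡3+m)))
      into : (0 , 2 + m) ∷ map φ (encode t) ⊆ chords 0 t
      into (here refl) = base∈chords
      into (there q) with e , r , refl ← ∈-map⁻ φ q = proj₂ (∈-encode⁻ r)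
      onto : chords 0 t ⊆ (0 , 2 + m) ∷ map φ (encode t)
      onto {x , z} q
        with y , p ← ∈-chords⁻ 0 t q
        with (v , u , w) , r , refl ← ∈triples⇒triangle p
        with (v<u , u<w) , _ , _ , vw ← ∈-triangles⁻ {encode t} r
        with vw
      ... | inj₂ s = there (∈-map⁺ φ s)
      ... | inj₁ (inj₂ (v≡0 , 1+w≡n)) = here (cong₂ _,_ v≡0 (last-vertex 1+w≡n))
      ... | inj₁ (inj₁ eq) = contradiction
        (<-≤-trans (s≤s v<u) (≤-trans u<w (≤-reflexive (sym eq)))) (<-irrefl refl)

    encode-noncrossing : AllPairs Noncrossing (encode t)
    encode-noncrossing = allPairs-∈ λ p q → λ
      { (inj₁ (v<x , x<w , w<y)) → chords-noncrossing t (chord p) (chord q) v<x x<w w<y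
      ; (inj₂ (x<v , v<y , y<w)) → chords-noncrossing t (chord q) (chord p) x<v v<y y<w }
      where
      chord : ∀ {e} → e ∈ encode t → φ e ∈ chords 0 t
      chord q = proj₂ (∈-encode⁻ q)

    encode-∈-triangulations : encode t ∈ triangulations
    encode-∈-triangulations = ∈-filter⁺ isTriangulation? (filter-∈-sublists (inner? t) diagonals)
      (trans length-encode (cong (_∸ 3) (sym n≡3+m)) , encode-noncrossing ,
       trans length-triangles (cong (_∸ 2) (sym n≡3+m)))

  encode-injective : ∀ {s t} → size s ≡ suc m → size t ≡ suc m → encode s ≡ encode t → s ≡ t
  encode-injective {s} {t} p q eq = triples-injective s t (trans p (sym q)) λ r →
    case ∈triples⇒triangle p r of λ
      { (_ , u , refl) → triangle⇒∈triples q (subst (λ T → _ ∈ triangles T) eq u) }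

  triangulations-unique : Unique triangulations
  triangulations-unique = Unique.filter⁺ isTriangulation? (sublists-unique diagonals-unique)

  -- From triangulations back to trees.

  module Decoding {T : List Chord} (T∈ : T ∈ triangulations) where

    T⊆ : T ∈ sublists diagonals
    T⊆ = proj₁ (∈-filter⁻ isTriangulation? {xs = sublists diagonals} T∈)

    isTri : IsTriangulation T
    isTri = proj₂ (∈-filter⁻ isTriangulation? {xs = sublists diagonals} T∈)

    length-T : length T ≡ m
    length-T = trans (proj₁ isTri) (cong (_∸ 3) n≡3+m)

    length-triangles-T : length (triangles T) ≡ suc m
    length-triangles-T = trans (proj₂ (proj₂ isTri)) (cong (_∸ 2) n≡3+m)

    -- Each of two crossing edges has a vertex strictly inside its interval and one strictly
    -- outside. A unit side has none inside, the side from 0 to n - 1 none outside, so both edges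
    -- would be diagonals of `T`.
    edges-noncrossing : ∀ {v w v′ w′} → Edge T (v , w) → Edge T (v′ , w′) →
      toℕ v < toℕ v′ → toℕ v′ < toℕ w → ¬ toℕ w < toℕ w′
    edges-noncrossing (inj₁ (inj₁ eq)) _ a b c = <⇒≱ a (≤-pred (≤-trans b (≤-reflexive (sym eq))))
    edges-noncrossing {w′ = w′} (inj₁ (inj₂ (_ , eq))) _ a b c =
      <⇒≱ (Fin.toℕ<n w′) (≤-trans (≤-reflexive (sym eq)) c)
    edges-noncrossing (inj₂ _) (inj₁ (inj₁ eq)) a b c = <⇒≱ c (≤-trans (≤-reflexive (sym eq)) b)
    edges-noncrossing (inj₂ _) (inj₁ (inj₂ (eq , _))) a b c = <⇒≱ a (≤-trans (≤-reflexive eq) z≤n)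
    edges-noncrossing (inj₂ p) (inj₂ q) a b c with ∈-AllPairs₂ (proj₁ (proj₂ isTri)) p q
    ... | inj₁ refl         = <-irrefl refl a
    ... | inj₂ (inj₁ cross) = cross (inj₁ (a , b , c))
    ... | inj₂ (inj₂ cross) = cross (inj₂ (a , b , c))

    outerChord : Triple → Chord
    outerChord (x , y , z) = x , z

    -- Triangles on the same longest edge with different apexes have crossing edges. This makes
    -- `outerChord` injective for the counting in `split`.
    apex-unique : ∀ {σ τ} → σ ∈ triangles T → τ ∈ triangles T → outerChord σ ≡ outerChord τ → σ ≡ τ
    apex-unique {x , y , z} {_ , y′ , _} p q refl
      with (x<y , y<z) , xy , yz , xz ← ∈-triangles⁻ {T} p
      with (x<y′ , y′<z) , xy′ , y′z , _ ← ∈-triangles⁻ {T} q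
      with <-cmp (toℕ y) (toℕ y′)
    ... | tri< y<y′ _ _ = contradiction y′<z (edges-noncrossing xy′ yz x<y y<y′)
    ... | tri> _ _ y′<y = contradiction y<z (edges-noncrossing xy y′z x<y′ y′<y)
    ... | tri≈ _ eq _ with refl ← Fin.toℕ-injective eq = refl

    longEdge : ∀ {v w} → suc (toℕ v) < toℕ w → Edge T (v , w) → (v , w) ∈ base ∷ T
    longEdge lt (inj₁ (inj₁ eq)) = contradiction lt (<-irrefl eq)
    longEdge lt (inj₁ (inj₂ (v≡0 , 1+w≡n))) =
      here (φ-injective (trans (cong₂ _,_ v≡0 (last-vertex 1+w≡n)) (sym φ-base)))
    longEdge lt (inj₂ q) = there q

    -- The n - 2 triangles have distinct outer chords, and these lie among the
    -- n - 2 edges that are not sides v, v + 1: each such edge carries a triangle.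
    split : ∀ {v w} → suc (toℕ v) < toℕ w → Edge T (v , w) → ∃[ y ] Triangle T (v , y , w)
    split lt e with ∈-map⁻ outerChord (full (longEdge lt e))
      where
      into : map outerChord (triangles T) ⊆ base ∷ T
      into q with (x , y , z) , r , refl ← ∈-map⁻ outerChord q
             with (x<y , y<z) , _ , _ , xz ← ∈-triangles⁻ {T} r =
        longEdge (<-≤-trans (s≤s x<y) y<z) xz
      full : base ∷ T ⊆ map outerChord (triangles T)
      full = unique-⊆-full (≡-dec Fin._≟_ Fin._≟_)
        (unique-map⁺-∈ apex-unique (triangles-unique T)) into
        (≤-reflexive (trans (cong suc length-T)
          (trans (sym length-triangles-T) (sym (length-map outerChord (triangles T))))))
    ... | (_ , y , _) , r , refl = y , ∈-triangles⁻ {T} r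

    -- The fuel `f` bounds the length of the interval; both shorter edges of the triangle found by
    -- `split` lower it. Only one direction is recorded here, that triples are triangles of `T`: the
    -- converse comes from counting in `decoded`.
    build : ∀ f {v w} → toℕ w ≤ f + toℕ v → toℕ v < toℕ w → Edge T (v , w) →
      ∃[ t ] end (toℕ v) t ≡ toℕ w ×
             (∀ {τ} → τ ∈ triples (toℕ v) t → ∃[ σ ] Triangle T σ × τ ≡ ψ σ)
    build zero le lt e = contradiction lt (≤⇒≯ le)
    build (suc f) {v} {w} le lt e with suc (toℕ v) ≟ toℕ w
    ... | yes eq = leaf , eq , λ ()
    ... | no neq
      with y , tri@((v<y , y<w) , vy , yw , vw) ← split (≤∧≢⇒< lt neq) e
      with l , l-end , l-tri ← build f (≤-pred (≤-trans y<w le)) v<y vy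
      with r , r-end , r-tri ← build f {y} {w}
             (≤-trans le (≤-trans (≤-reflexive (sym (+-suc f (toℕ v)))) (+-monoʳ-≤ f v<y))) y<w yw
      = node l r , end-eq , λ q → case nodeView {toℕ v} {l} {r} q of λ
          { (root refl) → (v , y , w) , tri , cong (toℕ v ,_) (cong₂ _,_ l-end end-eq)
          ; (left q)  → l-tri q
          ; (right q) → r-tri (subst (λ c → _ ∈ triples c r) l-end q) }
      where
      end-eq : end (end (toℕ v) l) r ≡ toℕ w
      end-eq = trans (cong (λ c → end c r) l-end) r-end

    built : ∃[ t ] end (toℕ (proj₁ base)) t ≡ toℕ (proj₂ base) ×
            (∀ {τ} → τ ∈ triples (toℕ (proj₁ base)) t → ∃[ σ ] Triangle T σ × τ ≡ ψ σ)
    built = build n (≤-trans (<⇒≤ (Fin.toℕ<n (proj₂ base))) (m≤m+n n _))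
      (subst₂ _<_ (sym (cong proj₁ φ-base)) (sym (cong proj₂ φ-base)) (s≤s z≤n))
      (inj₁ (inj₂ (cong proj₁ φ-base , trans (cong suc (cong proj₂ φ-base)) (sym n≡3+m))))

    decoded : ∃[ t ] size t ≡ suc m × T ≡ encode t
    decoded = t , size≡ , sublist-filter (inner? t) diagonals-unique T⊆ T⇒chord chord⇒T
      where
      t : Tree
      t = proj₁ built
      t-end : end 0 t ≡ 2 + m
      t-end = trans (cong (λ a → end a t) (sym (cong proj₁ φ-base)))
        (trans (proj₁ (proj₂ built)) (cong proj₂ φ-base))
      t-tri : ∀ {τ} → τ ∈ triples 0 t → ∃[ σ ] Triangle T σ × τ ≡ ψ σ
      t-tri q = proj₂ (proj₂ built) (subst (λ a → _ ∈ triples a t) (sym (cong proj₁ φ-base)) q)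
      size≡ : size t ≡ suc m
      size≡ = suc-injective (trans (sym (end≡ 0 t)) t-end)
      into : triples 0 t ⊆ map ψ (triangles T)
      into q with σ , tri , refl ← t-tri q = ∈-map⁺ ψ (∈-triangles tri)
      -- Both lists are repetition-free with `suc m` entries, so the inclusion `into` can be
      -- reversed.
      full : map ψ (triangles T) ⊆ triples 0 t
      full = unique-⊆-full (≡-dec _≟_ (≡-dec _≟_ _≟_)) (triples-unique 0 t) into
        (≤-reflexive (trans (length-map ψ (triangles T)) (trans length-triangles-T
          (trans (sym size≡) (sym (length-triples 0 t))))))
      T⇒chord : ∀ {e} → e ∈ T → φ e ∈ chords 0 t
      T⇒chord {v , w} q
        with v<w , ¬side ← ∈-diagonals⁻ (sublists-⊆ T⊆ q)
        with y , tri ← split (≤∧≢⇒< v<w (λ eq → ¬side (inj₁ eq))) (inj₂ q) =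
        ∈-chords⁺ 0 t (full (∈-map⁺ ψ (∈-triangles tri)))
      chord⇒T : ∀ {e} → e ∈ diagonals → φ e ∈ chords 0 t → e ∈ T
      chord⇒T {v , w} d q
        with y , r ← ∈-chords⁻ 0 t q
        with (v′ , y′ , w′) , (_ , _ , _ , vw) , eq ← t-tri r
        with refl ← Fin.toℕ-injective {i = v} {v′} (cong proj₁ eq)
        with refl ← Fin.toℕ-injective {i = w} {w′} (cong (proj₂ ∘ proj₂) eq)
        with vw
      ... | inj₁ side = contradiction side (proj₂ (∈-diagonals⁻ d))
      ... | inj₂ s    = s

  open Decoding using (decoded) public

-- Counting trees and forests

concatMap-unique : (f : A → List B) {xs : List A} → Unique xs →
  (∀ {x} → x ∈ xs → Unique (f x)) →
  (∀ {x y z} → x ∈ xs → y ∈ xs → z ∈ f x → z ∈ f y → x ≡ y) →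
  Unique (concatMap f xs)
concatMap-unique f [] _ _ = []
concatMap-unique f {x ∷ xs} (x∉ ∷ u) uf dis = Unique.++⁺ (uf (here refl))
  (concatMap-unique f u (uf ∘ there) (λ p q → dis (there p) (there q)))
  λ { (p , q) → case find (∈-concatMap⁻ f {xs} q) of λ
    { (y , y∈ , r) → ListAll.lookup x∉ y∈ (dis (here refl) (there y∈) p r) } }

length-concatMap : (f : A → List B) (xs : List A) →
                   length (concatMap f xs) ≡ ListAction.sum (map (length ∘ f) xs)
length-concatMap f []       = refl
length-concatMap f (x ∷ xs) =
  trans (length-++ (f x)) (cong (_+_ (length (f x))) (length-concatMap f xs))

sum-map-*ʳ : {f g : A → ℕ} (c : ℕ) (xs : List A) →
             (∀ {x} → x ∈ xs → f x * c ≡ g x) →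
             ListAction.sum (map f xs) * c ≡ ListAction.sum (map g xs)
sum-map-*ʳ c []       eq = refl
sum-map-*ʳ {f = f} c (x ∷ xs) eq = trans (*-distribʳ-+ c (f x) _)
  (cong₂ _+_ (eq (here refl)) (sum-map-*ʳ c xs (eq ∘ there)))

sum-map-cong-∈ : {f g : A → ℕ} (xs : List A) →
                 (∀ {x} → x ∈ xs → f x ≡ g x) →
                 ListAction.sum (map f xs) ≡ ListAction.sum (map g xs)
sum-map-cong-∈ []       eq = refl
sum-map-cong-∈ (x ∷ xs) eq = cong₂ _+_ (eq (here refl)) (sum-map-cong-∈ xs (eq ∘ there))

length-cartesianProductWith : ∀ {c} {C : Set c} (f : A → B → C) xs ys →
  length (cartesianProductWith f xs ys) ≡ length xs * length ys
length-cartesianProductWith f []       ys = refl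
length-cartesianProductWith f (x ∷ xs) ys = trans (length-++ (map (f x) ys))
  (cong₂ _+_ (length-map (f x) ys) (length-cartesianProductWith f xs ys))

total : ∀ {K} → Vec Tree K → ℕ
total []       = 0
total (t ∷ ts) = size t + total ts

graft : ∀ {K} → Vec Tree (2 + K) → Vec Tree (1 + K)
graft (l ∷ r ∷ ts) = node l r ∷ ts

-- Removing the root of the first tree, rather than the whole first tree, makes
-- the number of forests of K trees with j nodes obey the ballot recurrence.
forests : (j K : ℕ) → List (Vec Tree K)
forests zero    zero    = [] ∷ []
forests zero    (suc K) = map (leaf ∷_) (forests zero K)
forests (suc j) zero    = []
forests (suc j) (suc K) = map (leaf ∷_) (forests (suc j) K) ++ map graft (forests j (2 + K))

∈-forests⁺ : ∀ j {K} (ts : Vec Tree K) → total ts ≡ j → ts ∈ forests j K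
∈-forests⁺ zero    []              eq = here refl
∈-forests⁺ zero    (leaf ∷ ts)     eq = ∈-map⁺ (leaf ∷_) (∈-forests⁺ zero ts eq)
∈-forests⁺ (suc j) (leaf ∷ ts)     eq = ∈-++⁺ˡ (∈-map⁺ (leaf ∷_) (∈-forests⁺ (suc j) ts eq))
∈-forests⁺ (suc j) (node l r ∷ ts) eq = ∈-++⁺ʳ (map (leaf ∷_) (forests (suc j) _))
  (∈-map⁺ graft (∈-forests⁺ j (l ∷ r ∷ ts)
    (trans (sym (+-assoc (size l) (size r) (total ts))) (suc-injective eq))))

total-graft : ∀ {K} (ts : Vec Tree (2 + K)) → total (graft ts) ≡ suc (total ts)
total-graft (l ∷ r ∷ ts) = cong suc (+-assoc (size l) (size r) (total ts))

forests-total : ∀ j K → ListAll.All (λ ts → total ts ≡ j) (forests j K)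
forests-total zero    zero    = refl ∷ []
forests-total zero    (suc K) = ListAllₚ.map⁺ (forests-total zero K)
forests-total (suc j) zero    = []
forests-total (suc j) (suc K) = ListAllₚ.++⁺
  (ListAllₚ.map⁺ (forests-total (suc j) K))
  (ListAllₚ.map⁺ (ListAll.map (λ {ts} eq → trans (total-graft ts) (cong suc eq))
    (forests-total j (2 + K))))

∈-forests⁻ : ∀ j K {ts : Vec Tree K} → ts ∈ forests j K → total ts ≡ j
∈-forests⁻ j K = ListAll.lookup (forests-total j K)

graft-injective : ∀ {K} {ts us : Vec Tree (2 + K)} → graft ts ≡ graft us → ts ≡ us
graft-injective {ts = _ ∷ _ ∷ _} {_ ∷ _ ∷ _} refl = refl

leaf∷≢graft : ∀ {K} {ts : Vec Tree K} us → leaf ∷ ts ≢ graft us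
leaf∷≢graft (_ ∷ _ ∷ _) ()

forests-unique : ∀ j K → Unique (forests j K)
forests-unique zero    zero    = [] ∷ []
forests-unique zero    (suc K) = Unique.map⁺ (cong Vec.tail) (forests-unique zero K)
forests-unique (suc j) zero    = []
forests-unique (suc j) (suc K) = Unique.++⁺
  (Unique.map⁺ (cong Vec.tail) (forests-unique (suc j) K))
  (Unique.map⁺ graft-injective (forests-unique j (2 + K)))
  λ { (p , q) → case ∈-map⁻ (leaf ∷_) p , ∈-map⁻ graft q of λ
    { ((_ , _ , refl) , (us , _ , eq)) → leaf∷≢graft us eq } }

private
  -- The ballot recurrence with `A`, `B`, `J` in place of (2 + j + k)!, (2 + 2j + k)! and j!, which
  -- leaves polynomial identities to the ring solver. The decisive one is (3 + j + k)(k + 1) + (j +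
  -- 1)(k + 3) = (k + 2)(3 + 2j + k).
  ballot-step : ∀ f g A B J j k →
    f * A * (suc j * J) ≡ suc k * B →
    g * ((3 + (j + k)) * A) * J ≡ (3 + k) * B →
    (f + g) * ((3 + (j + k)) * A) * (suc j * J) ≡ (2 + k) * ((3 + (j + j + k)) * B)
  ballot-step f g A B J j k p q = begin
    (f + g) * ((3 + (j + k)) * A) * (suc j * J)
      ≡⟨ regroup f g A J j k ⟩
    (3 + (j + k)) * (f * A * (suc j * J)) + suc j * (g * ((3 + (j + k)) * A) * J)
      ≡⟨ cong₂ (λ u v → (3 + (j + k)) * u + suc j * v) p q ⟩
    (3 + (j + k)) * (suc k * B) + suc j * ((3 + k) * B)
      ≡⟨ collect B j k ⟩
    (2 + k) * ((3 + (j + j + k)) * B) ∎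
    where
    open ≡-Reasoning
    regroup : ∀ f g A J j k → (f + g) * ((3 + (j + k)) * A) * (suc j * J) ≡
              (3 + (j + k)) * (f * A * (suc j * J)) + suc j * (g * ((3 + (j + k)) * A) * J)
    regroup = solve-∀
    collect : ∀ B j k → (3 + (j + k)) * (suc k * B) + suc j * ((3 + k) * B) ≡
              (2 + k) * ((3 + (j + j + k)) * B)
    collect = solve-∀

-- The ballot formula K / (2j + K) · binom(2j + K, j), at K = k + 1, without division.
length-forests : ∀ j k →
  length (forests j (suc k)) * (j + suc k) ! * j ! ≡ suc k * (j + j + k) !
length-forests zero k = trans (*-identityʳ _)
  (trans (cong (_* (suc k) !) (length-0 (suc k))) (*-identityˡ _))
  where
  length-0 : ∀ K → length (forests 0 K) ≡ 1
  length-0 zero    = refl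
  length-0 (suc K) = trans (length-map (leaf ∷_) (forests 0 K)) (length-0 K)
length-forests (suc j) zero = begin
  length (map graft (forests j 2)) * (suc j + 1) ! * suc j !
    ≡⟨ cong₂ (λ u v → u * v ! * suc j !) (length-map graft (forests j 2)) (sym (+-suc j 1)) ⟩
  length (forests j 2) * (j + 2) ! * (suc j * j !)
    ≡⟨ x*[y*z]≡y*[x*z] (length (forests j 2) * (j + 2) !) (suc j) (j !) ⟩
  suc j * (length (forests j 2) * (j + 2) ! * j !)
    ≡⟨ cong (suc j *_) (length-forests j 1) ⟩
  suc j * (2 * (j + j + 1) !)
    ≡⟨ cong (λ u → suc j * (2 * u !)) (+-comm (j + j) 1) ⟩
  suc j * (2 * (suc (j + j)) !)
    ≡⟨ double j ((suc (j + j)) !) ⟩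
  1 * (suc (suc (j + j)) * (suc (j + j)) !)
    ≡⟨ cong (λ u → 1 * u !) (normal j) ⟩
  1 * (suc j + suc j + 0) ! ∎
  where
  open ≡-Reasoning
  double : ∀ j B → suc j * (2 * B) ≡ 1 * (suc (suc (j + j)) * B)
  double = solve-∀
  normal : ∀ j → suc (suc (j + j)) ≡ suc j + suc j + 0
  normal = solve-∀
length-forests (suc j) (suc k) = begin
  length (forests (suc j) (2 + k)) * (suc j + suc (suc k)) ! * suc j !
    ≡⟨ cong₂ (λ u v → u * v ! * suc j !) split-length (shift₁ j k) ⟩
  (length (forests (suc j) (suc k)) + length (forests j (3 + k))) *
    ((3 + (j + k)) * (2 + (j + k)) !) * (suc j * j !)
    ≡⟨ ballot-step (length (forests (suc j) (suc k))) (length (forests j (3 + k)))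
         ((2 + (j + k)) !) ((2 + (j + j + k)) !) (j !) j k
         (subst₂ (λ u v → length (forests (suc j) (suc k)) * u ! * suc j ! ≡ suc k * v !)
           (shift₂ j k) (shift₃ j k) (length-forests (suc j) k))
         (subst₂ (λ u v → length (forests j (3 + k)) * u ! * j ! ≡ (3 + k) * v !)
           (shift₄ j k) (shift₅ j k) (length-forests j (2 + k))) ⟩
  (2 + k) * (3 + (j + j + k)) !
    ≡⟨ cong (λ u → (2 + k) * u !) (shift₆ j k) ⟩
  (2 + k) * (suc j + suc j + suc k) ! ∎
  where
  open ≡-Reasoning
  split-length : length (forests (suc j) (2 + k)) ≡
                 length (forests (suc j) (suc k)) + length (forests j (3 + k))
  split-length = trans (length-++ (map (leaf ∷_) (forests (suc j) (suc k))))
    (cong₂ _+_ (length-map (leaf ∷_) (forests (suc j) (suc k)))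
              (length-map graft (forests j (3 + k))))
  shift₁ : ∀ j k → suc j + suc (suc k) ≡ 3 + (j + k)
  shift₁ = solve-∀
  shift₂ : ∀ j k → suc j + suc k ≡ 2 + (j + k)
  shift₂ = solve-∀
  shift₃ : ∀ j k → suc j + suc j + k ≡ 2 + (j + j + k)
  shift₃ = solve-∀
  shift₄ : ∀ j k → j + suc (2 + k) ≡ 3 + (j + k)
  shift₄ = solve-∀
  shift₅ : ∀ j k → j + j + (2 + k) ≡ 2 + (j + j + k)
  shift₅ = solve-∀
  shift₆ : ∀ j k → 3 + (j + j + k) ≡ suc j + suc j + suc k
  shift₆ = solve-∀

-- Single trees and the Catalan numbers.

trees : ℕ → List Tree
trees m = map Vec.head (forests m 1)

∈-trees⁺ : ∀ m {t} → size t ≡ m → t ∈ trees m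
∈-trees⁺ m {t} eq = ∈-map⁺ Vec.head (∈-forests⁺ m (t ∷ []) (trans (+-identityʳ (size t)) eq))

∈-trees⁻ : ∀ m {t} → t ∈ trees m → size t ≡ m
∈-trees⁻ m q with (t ∷ []) , r , refl ← ∈-map⁻ Vec.head q =
  trans (sym (+-identityʳ (size t))) (∈-forests⁻ m 1 r)

trees-unique : ∀ m → Unique (trees m)
trees-unique m = Unique.map⁺ head-injective (forests-unique m 1)
  where
  head-injective : {ts us : Vec Tree 1} → Vec.head ts ≡ Vec.head us → ts ≡ us
  head-injective {_ ∷ []} {_ ∷ []} refl = refl

-- For one tree the ballot formula says that the length times (m + 1)! m! is (2m)!. Cancelling m! m!
-- makes the central binomial coefficient a multiple of m + 1, so the division in `catalan` is
-- exact.
length-trees : ∀ m → length (trees m) ≡ catalan m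
length-trees m = begin
  length (trees m)             ≡⟨ m*n/n≡m (length (trees m)) (suc m) ⟨
  length (trees m) * suc m / suc m ≡⟨ cong (_/ suc m) (sym central) ⟩
  catalan m                    ∎
  where
  open ≡-Reasoning
  m≤2m : m ≤ 2 * m
  m≤2m = m≤m+n m (m + 0)
  nonZero : NonZero (m ! * m !)
  nonZero = m !* m !≢0
  regroup : ∀ f m M → f * suc m * (M * M) ≡ f * (suc m * M) * M
  regroup = solve-∀
  central : (2 * m) C m ≡ length (trees m) * suc m
  central = *-cancelʳ-≡ _ _ (m ! * m !) {{nonZero}} (begin
    ((2 * m) C m) * (m ! * m !)
      ≡⟨ cong (λ u → ((2 * m) C m) * (m ! * u !)) (trans (m+n∸m≡n m (m + 0)) (+-identityʳ m)) ⟨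
    ((2 * m) C m) * (m ! * (2 * m ∸ m) !)
      ≡⟨ cong (_* (m ! * (2 * m ∸ m) !)) (nCk≡n!/k![n-k]! m≤2m) ⟩
    ((2 * m) ! / (m ! * (2 * m ∸ m) !)) {{m !* (2 * m ∸ m) !≢0}} * (m ! * (2 * m ∸ m) !)
      ≡⟨ m/n*n≡m {{m !* (2 * m ∸ m) !≢0}} (k![n∸k]!∣n! m≤2m) ⟩
    (2 * m) !                              ≡⟨ cong _! (+-assoc m m 0) ⟨
    (m + m + 0) !                          ≡⟨ *-identityˡ _ ⟨
    1 * (m + m + 0) !                      ≡⟨ length-forests m 0 ⟨
    length (forests m 1) * (m + 1) ! * m !
      ≡⟨ cong₂ (λ u v → u * v ! * m !) (length-map Vec.head (forests m 1)) (+-comm 1 m) ⟨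
    length (trees m) * (suc m * m !) * m ! ≡⟨ regroup (length (trees m)) m (m !) ⟨
    length (trees m) * suc m * (m ! * m !) ∎)

-- Multiplicity vectors and multinomial coefficients.

bump : ℕ → Vec ℕ m → Vec ℕ m
bump s       []      = []
bump zero    (x ∷ k) = suc x ∷ k
bump (suc s) (x ∷ k) = x ∷ bump s k

entry : ℕ → Vec ℕ m → ℕ
entry s       []      = 0
entry zero    (x ∷ k) = x
entry (suc s) (x ∷ k) = entry s k

bump-injective : ∀ s {k k′ : Vec ℕ m} → bump s k ≡ bump s k′ → k ≡ k′
bump-injective s       {[]}    {[]}    eq   = refl
bump-injective zero    {x ∷ k} {y ∷ l} refl = refl
bump-injective (suc s) {x ∷ k} {y ∷ l} eq   =
  cong₂ _∷_ (∷-injectiveˡ eq) (bump-injective s (∷-injectiveʳ eq))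

lookup-bump : ∀ {s} (k : Vec ℕ m) i → s ≡ toℕ i → lookup (bump s k) i ≡ suc (lookup k i)
lookup-bump (x ∷ k) zero    refl = refl
lookup-bump (x ∷ k) (suc i) refl = lookup-bump k i refl

lookup-bump-≢ : ∀ s (k : Vec ℕ m) i → s ≢ toℕ i → lookup (bump s k) i ≡ lookup k i
lookup-bump-≢ zero    (x ∷ k) zero    neq = contradiction refl neq
lookup-bump-≢ zero    (x ∷ k) (suc i) neq = refl
lookup-bump-≢ (suc s) (x ∷ k) zero    neq = refl
lookup-bump-≢ (suc s) (x ∷ k) (suc i) neq = lookup-bump-≢ s k i (neq ∘ cong suc)

sum-bump : ∀ {s} (k : Vec ℕ m) → s < m → sum (bump s k) ≡ suc (sum k)
sum-bump {s = zero}  (x ∷ k) _         = refl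
sum-bump {s = suc s} (x ∷ k) (s≤s s<m) = trans (cong (_+_ x) (sum-bump k s<m)) (+-suc x (sum k))

-- The weight is an arbitrary `g` because passing to the tail shifts all indices: the induction
-- hypothesis is used for `g ∘ suc`.
weighted-bump : ∀ (g : ℕ → ℕ) {s} (k : Vec ℕ m) → s < m →
  sum (tabulate λ i → g (toℕ i) * lookup (bump s k) i) ≡
  g s + sum (tabulate λ i → g (toℕ i) * lookup k i)
weighted-bump g {zero} (x ∷ k) _ =
  trans (cong (_+ rest) (*-suc (g 0) x)) (+-assoc (g 0) (g 0 * x) rest)
  where rest = sum (tabulate λ i → g (suc (toℕ i)) * lookup k i)
weighted-bump g {suc s} (x ∷ k) (s≤s s<m) =
  trans (cong (_+_ (g 0 * x)) (weighted-bump (g ∘ suc) k s<m))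
        (x+[y+z]≡y+[x+z] (g 0 * x) (g (suc s)) _)

powers-bump : ∀ (g : ℕ → ℕ) {s} (k : Vec ℕ m) → s < m →
  product (toList (tabulate λ i → g (toℕ i) ^ lookup (bump s k) i)) ≡
  g s * product (toList (tabulate λ i → g (toℕ i) ^ lookup k i))
powers-bump g {zero} (x ∷ k) _ = *-assoc (g 0) (g 0 ^ x) _
powers-bump g {suc s} (x ∷ k) (s≤s s<m) =
  trans (cong (g 0 ^ x *_) (powers-bump (g ∘ suc) k s<m)) (x*[y*z]≡y*[x*z] (g 0 ^ x) (g (suc s)) _)

factorials : Vec ℕ m → ℕ
factorials k = product (map _! (toList k))

factorials-bump : ∀ {s} (k : Vec ℕ m) → s < m →
                  factorials (bump s k) ≡ suc (entry s k) * factorials k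
factorials-bump {s = zero}  (x ∷ k) _         = *-assoc (suc x) (x !) (factorials k)
factorials-bump {s = suc s} (x ∷ k) (s≤s s<m) =
  trans (cong (x ! *_) (factorials-bump k s<m))
        (x*[y*z]≡y*[x*z] (x !) (suc (entry s k)) (factorials k))

removeHead : Vec ℕ (suc m) → List (ℕ × Vec ℕ (suc m))
removeHead (zero  ∷ k) = []
removeHead (suc x ∷ k) = (0 , x ∷ k) ∷ []

under : ℕ → ℕ × Vec ℕ m → ℕ × Vec ℕ (suc m)
under x (s , k) = suc s , x ∷ k

-- All ways to write the vector as `bump s k′` with `s` in range. Here `s` will be the first letter
-- of a word, or the size of the first tree of a forest.
removals : Vec ℕ m → List (ℕ × Vec ℕ m)
removals []      = []
removals (x ∷ k) = removeHead (x ∷ k) ++ map (under x) (removals k)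

∈-removals⁺ : ∀ {s} (k : Vec ℕ m) → s < m → (s , k) ∈ removals (bump s k)
∈-removals⁺ {s = zero}  (x ∷ k) _         = here refl
∈-removals⁺ {s = suc s} (x ∷ k) (s≤s s<m) =
  ∈-++⁺ʳ (removeHead (x ∷ bump s k)) (∈-map⁺ (under x) (∈-removals⁺ k s<m))

∈-removals⁻ : ∀ {s k′} (k : Vec ℕ m) → (s , k′) ∈ removals k → s < m × bump s k′ ≡ k
∈-removals⁻ (x ∷ k) q with ∈-++⁻ (removeHead (x ∷ k)) q
∈-removals⁻ (suc x ∷ k) q | inj₁ (here refl) = s≤s z≤n , refl
... | inj₂ r with _ , p , refl ← ∈-map⁻ (under x) r
             with s<m , eq ← ∈-removals⁻ k p = s≤s s<m , cong (x ∷_) eq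

removals-unique : (k : Vec ℕ m) → Unique (removals k)
removals-unique []      = []
removals-unique (x ∷ k) = Unique.++⁺ (head-unique x)
  (Unique.map⁺ (λ { refl → refl }) (removals-unique k))
  λ { (p , q) → case ∈-map⁻ (under x) q of λ { (_ , _ , refl) → not-under x p } }
  where
  head-unique : ∀ x → Unique (removeHead (x ∷ k))
  head-unique zero    = []
  head-unique (suc x) = [] ∷ []
  not-under : ∀ x {s l} → ¬ (suc s , l) ∈ removeHead (x ∷ k)
  not-under (suc x) (here ())
  not-under (suc x) (there ())

-- The summand is the entry of `k` at the removed position `s`, and positions with entry 0 admit no
-- removal.
sum-removals : (k : Vec ℕ m) →
               ListAction.sum (map (λ (s , k′) → suc (entry s k′)) (removals k)) ≡ sum k
sum-removals []          = refl
sum-removals (zero ∷ k)  = trans (cong ListAction.sum (sym (map-∘ (removals k)))) (sum-removals k)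
sum-removals (suc x ∷ k) = cong (_+_ (suc x))
  (trans (cong ListAction.sum (sym (map-∘ (removals k)))) (sum-removals k))

-- The number of words with k_i letters i, counted by the first letter.
words : ℕ → Vec ℕ m → ℕ
words zero    k = 1
words (suc K) k = ListAction.sum (map (λ (s , k′) → words K k′) (removals k))

removals-sum : ∀ {s k′} {k : Vec ℕ m} → sum k ≡ suc K → (s , k′) ∈ removals k → sum k′ ≡ K
removals-sum {k′ = k′} {k} eq p with s<m , refl ← ∈-removals⁻ k p =
  suc-injective (trans (sym (sum-bump k′ s<m)) eq)

sum≡0⇒zeros : (k : Vec ℕ m) → sum k ≡ 0 → k ≡ replicate m 0
sum≡0⇒zeros []         eq = refl
sum≡0⇒zeros (zero ∷ k) eq = cong (0 ∷_) (sum≡0⇒zeros k eq)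

factorials-zeros : ∀ m → factorials (replicate m 0) ≡ 1
factorials-zeros zero    = refl
factorials-zeros (suc m) = trans (+-identityʳ _) (factorials-zeros m)

powers-zeros : ∀ (g : ℕ → ℕ) m →
  product (toList (tabulate {n = m} λ i → g (toℕ i) ^ lookup (replicate m 0) i)) ≡ 1
powers-zeros g zero    = refl
powers-zeros g (suc m) = trans (+-identityʳ _) (powers-zeros (g ∘ suc) m)

weighted-zeros : ∀ (g : ℕ → ℕ) m →
  sum (tabulate {n = m} λ i → g (toℕ i) * lookup (replicate m 0) i) ≡ 0
weighted-zeros g zero    = refl
weighted-zeros g (suc m) = cong₂ _+_ (*-zeroʳ (g 0)) (weighted-zeros (g ∘ suc) m)

sum-zeros : ∀ m → sum (replicate m 0) ≡ 0
sum-zeros zero    = refl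
sum-zeros (suc m) = sum-zeros m

-- Fixing the first letter splits its multiplicity off the product of factorials and leaves K! by
-- induction; the multiplicities add up to K + 1.
words-factorials : ∀ K (k : Vec ℕ m) → sum k ≡ K → words K k * factorials k ≡ K !
words-factorials {m} zero k eq rewrite sum≡0⇒zeros k eq | factorials-zeros m = refl
words-factorials (suc K) k eq = begin
  ListAction.sum (map (λ (s , k′) → words K k′) (removals k)) * factorials k
    ≡⟨ sum-map-*ʳ {f = λ (s , k′) → words K k′} (factorials k) (removals k) term ⟩
  ListAction.sum (map (λ (s , k′) → suc (entry s k′) * K !) (removals k))
    ≡⟨ sum-map-*ʳ {f = λ (s , k′) → suc (entry s k′)} (K !) (removals k) (λ _ → refl) ⟨
  ListAction.sum (map (λ (s , k′) → suc (entry s k′)) (removals k)) * K !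
    ≡⟨ cong (_* K !) (trans (sum-removals k) eq) ⟩
  (suc K) ! ∎
  where
  open ≡-Reasoning
  term : ∀ {p} → p ∈ removals k →
         words K (proj₂ p) * factorials k ≡ suc (entry (proj₁ p) (proj₂ p)) * K !
  term {s , k′} p with s<m , bump≡ ← ∈-removals⁻ k p = begin
    words K k′ * factorials k
      ≡⟨ cong (λ l → words K k′ * factorials l) bump≡ ⟨
    words K k′ * factorials (bump s k′)
      ≡⟨ cong (words K k′ *_) (factorials-bump k′ s<m) ⟩
    words K k′ * (suc (entry s k′) * factorials k′)
      ≡⟨ x*[y*z]≡y*[x*z] (words K k′) (suc (entry s k′)) (factorials k′) ⟩
    suc (entry s k′) * (words K k′ * factorials k′)
      ≡⟨ cong (suc (entry s k′) *_) (words-factorials K k′ (removals-sum {k = k} eq p)) ⟩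
    suc (entry s k′) * K ! ∎

multinomial≡words : ∀ K (k : Vec ℕ m) → sum k ≡ K → multinomial K k ≡ words K k
multinomial≡words K k eq =
  trans (cong (λ u → (u / factorials k) {{nz}}) (sym (words-factorials K k eq)))
        (m*n/n≡m (words K k) (factorials k) {{nz}})
  where
  nz : NonZero (factorials k)
  nz = product≢0 (ListAllₚ.map⁺ (ListAll.universal _!≢0 (toList k)))

-- Forests with prescribed tree sizes, and the value of `Z`.

profile : ∀ m → Vec Tree K → Vec ℕ m
profile m []       = replicate m 0
profile m (t ∷ ts) = bump (size t) (profile m ts)

-- The recursion of `words`, with a letter `s` replaced by a choice of a tree of size `s`; each tree
-- contributes one Catalan factor. For zero trees the vector is not inspected, so membership is
-- characterised only under `sum k ≡ K`.
withProfile : ∀ K → Vec ℕ m → List (Vec Tree K)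
withProfile zero    k = [] ∷ []
withProfile (suc K) k = concatMap
  (λ (s , k′) → cartesianProductWith _∷_ (trees s) (withProfile K k′)) (removals k)

-- This bound keeps every tree size below `m`, so that no `bump` in `profile m` falls past the end
-- of the vector, where it does nothing.
head-fits : (t : Tree) (ts : Vec Tree K) → suc K + total (t ∷ ts) ≤ m → size t < m
head-fits {K} t ts =
  ≤-trans (s≤s (≤-trans (m≤m+n (size t) (total ts)) (m≤n+m (size t + total ts) K)))

tail-fits : (t : Tree) (ts : Vec Tree K) → suc K + total (t ∷ ts) ≤ m → K + total ts ≤ m
tail-fits {K} t ts = ≤-trans (+-mono-≤ (n≤1+n K) (m≤n+m (total ts) (size t)))

∈-withProfile⁺ : (ts : Vec Tree K) → K + total ts ≤ m → ts ∈ withProfile K (profile m ts)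
∈-withProfile⁺ [] le = here refl
∈-withProfile⁺ {suc K} {m} (t ∷ ts) le = ∈-concatMap⁺ _
  (lose (∈-removals⁺ (profile m ts) (head-fits t ts le))
    (∈-cartesianProductWith⁺ _∷_ (∈-trees⁺ (size t) refl) (∈-withProfile⁺ ts (tail-fits t ts le))))

-- A tree of size s raises the entry of weight s + 1: its s nodes and the spine node from which it
-- will hang.
profile-sum : (ts : Vec Tree K) → K + total ts ≤ m →
  sum (profile m ts) ≡ K × weightedSum (profile m ts) ≡ K + total ts
profile-sum {m = m} [] le = sum-zeros m , weighted-zeros suc m
profile-sum {suc K} {m} (t ∷ ts) le with p , q ← profile-sum {m = m} ts (tail-fits t ts le) =
  trans (sum-bump (profile m ts) (head-fits t ts le)) (cong suc p) ,
  trans (weighted-bump suc (profile m ts) (head-fits t ts le))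
    (trans (cong (_+_ (suc (size t))) q) (rearrange (size t) K (total ts)))
  where
  rearrange : ∀ s K u → suc s + (K + u) ≡ suc K + (s + u)
  rearrange = solve-∀

∈-withProfile⁻ : ∀ K (k : Vec ℕ m) {ts} → sum k ≡ K → ts ∈ withProfile K k →
                 profile m ts ≡ k × weightedSum k ≡ K + total ts
∈-withProfile⁻ {m} zero k eq (here refl) rewrite sum≡0⇒zeros k eq = refl , weighted-zeros suc m
∈-withProfile⁻ (suc K) k eq q
  with (s , k′) , p , r ← find (∈-concatMap⁻ _ {removals k} q)
  with t , ts , t∈ , ts∈ , refl ← ∈-cartesianProductWith⁻ _∷_ (trees s) (withProfile K k′) r
  with s<m , bump≡ ← ∈-removals⁻ k p
  with profile≡ , weight≡ ← ∈-withProfile⁻ K k′ (removals-sum {k = k} eq p) ts∈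
  with refl ← ∈-trees⁻ s t∈ | refl ← bump≡ =
    cong (bump s) profile≡ ,
    trans (weighted-bump suc k′ s<m) (trans (cong (_+_ (suc s)) weight≡) (rearrange s K (total ts)))
  where
  rearrange : ∀ s K u → suc s + (K + u) ≡ suc K + (s + u)
  rearrange = solve-∀

withProfile-unique : ∀ K (k : Vec ℕ m) → Unique (withProfile K k)
withProfile-unique zero    k = [] ∷ []
withProfile-unique (suc K) k = concatMap-unique _ (removals-unique k)
  (λ {p} _ → Unique.cartesianProductWith⁺ _∷_ (λ { refl → refl , refl })
    (trees-unique (proj₁ p)) (withProfile-unique K (proj₂ p)))
  disjoint
  where
  disjoint : ∀ {p q ts} → p ∈ removals k → q ∈ removals k →
    ts ∈ cartesianProductWith _∷_ (trees (proj₁ p)) (withProfile K (proj₂ p)) →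
    ts ∈ cartesianProductWith _∷_ (trees (proj₁ q)) (withProfile K (proj₂ q)) → p ≡ q
  disjoint {s , k′} {s′ , k″} p q r r′
    with t , ts , t∈ , _ , refl ← ∈-cartesianProductWith⁻ _∷_ (trees s) (withProfile K k′) r
    with t , ts , t∈′ , _ , refl ← ∈-cartesianProductWith⁻ _∷_ (trees s′) (withProfile K k″) r′
    with refl ← ∈-trees⁻ s t∈ | refl ← ∈-trees⁻ s′ t∈′ =
    cong (s ,_) (bump-injective s (trans (proj₂ (∈-removals⁻ k p)) (sym (proj₂ (∈-removals⁻ k q)))))

length-withProfile-words : ∀ K (k : Vec ℕ m) → sum k ≡ K →
                           length (withProfile K k) ≡ words K k * catalanProduct k
length-withProfile-words {m} zero k eq rewrite sum≡0⇒zeros k eq | powers-zeros catalan m = refl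
length-withProfile-words (suc K) k eq = begin
  length (withProfile (suc K) k)
    ≡⟨ length-concatMap _ (removals k) ⟩
  ListAction.sum
    (map (λ (s , k′) → length (cartesianProductWith _∷_ (trees s) (withProfile K k′))) (removals k))
    ≡⟨ sum-map-*ʳ {f = λ (s , k′) → words K k′} (catalanProduct k) (removals k) term ⟨
  words (suc K) k * catalanProduct k ∎
  where
  open ≡-Reasoning
  term : ∀ {p} → p ∈ removals k → words K (proj₂ p) * catalanProduct k ≡
         length (cartesianProductWith _∷_ (trees (proj₁ p)) (withProfile K (proj₂ p)))
  term {s , k′} p with s<m , bump≡ ← ∈-removals⁻ k p = begin
    words K k′ * catalanProduct k
      ≡⟨ cong (λ l → words K k′ * catalanProduct l) bump≡ ⟨
    words K k′ * catalanProduct (bump s k′)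
      ≡⟨ cong (words K k′ *_) (powers-bump catalan k′ s<m) ⟩
    words K k′ * (catalan s * catalanProduct k′)
      ≡⟨ x*[y*z]≡y*[x*z] (words K k′) (catalan s) (catalanProduct k′) ⟩
    catalan s * (words K k′ * catalanProduct k′)
      ≡⟨ cong₂ _*_ (length-trees s) (length-withProfile-words K k′ (removals-sum {k = k} eq p)) ⟨
    length (trees s) * length (withProfile K k′)
      ≡⟨ length-cartesianProductWith _∷_ (trees s) (withProfile K k′) ⟨
    length (cartesianProductWith _∷_ (trees s) (withProfile K k′)) ∎

length-withProfile : ∀ K (k : Vec ℕ m) → sum k ≡ K →
                     length (withProfile K k) ≡ multinomial K k * catalanProduct k
length-withProfile K k eq = trans (length-withProfile-words K k eq)
  (cong (_* catalanProduct k) (sym (multinomial≡words K k eq)))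

boundedVecs-unique : ∀ m b → Unique (boundedVecs m b)
boundedVecs-unique zero    b = [] ∷ []
boundedVecs-unique (suc m) b = Unique.cartesianProductWith⁺ _∷_ (λ { refl → refl , refl })
  (Unique.upTo⁺ (suc b)) (boundedVecs-unique m b)

∈-boundedVecs : ∀ {b} (p : Vec ℕ m) → sum p ≤ b → p ∈ boundedVecs m b
∈-boundedVecs []      le = here refl
∈-boundedVecs (x ∷ p) le = ∈-cartesianProductWith⁺ _∷_
  (∈-upTo⁺ (s≤s (≤-trans (m≤m+n x (sum p)) le)))
  (∈-boundedVecs p (≤-trans (m≤n+m (sum p) x) le))

-- Each forest has exactly one profile, so the lists `withProfile K p`, whose lengths are the
-- summands of `Z`, are disjoint and exhaust the forests. Here `m` is n - 2.
Z≡length-forests : ∀ m {K} → K ≤ m → Z (2 + m) K ≡ length (forests (m ∸ K) K)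
Z≡length-forests m {K} K≤m = begin
  Z (2 + m) K
    ≡⟨ sum-map-cong-∈ ps (λ p∈ → sym
         (length-withProfile K _ (proj₂ (proj₂ (∈-filter⁻ cond? {xs = boundedVecs m m} p∈))))) ⟩
  ListAction.sum (map (length ∘ withProfile K) ps)
    ≡⟨ length-concatMap (withProfile K) ps ⟨
  length (concatMap (withProfile K) ps)
    ≡⟨ unique-set-length
         (concatMap-unique (withProfile K) (Unique.filter⁺ cond? (boundedVecs-unique m m))
           (λ _ → withProfile-unique K _)
           λ p∈ q∈ r r′ → trans (sym (proj₁ (∈ps⁻ p∈ r))) (proj₁ (∈ps⁻ q∈ r′)))
         (forests-unique (m ∸ K) K) into onto ⟩
  length (forests (m ∸ K) K) ∎
  where
  open ≡-Reasoning
  cond? : Decidable λ (p : Vec ℕ m) → weightedSum p ≡ m × sum p ≡ K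
  cond? p = (weightedSum p ≟ m) ×-dec (sum p ≟ K)
  ps : List (Vec ℕ m)
  ps = filter cond? (boundedVecs m m)
  ∈ps⁻ : ∀ {p ts} → p ∈ ps → ts ∈ withProfile K p → profile m ts ≡ p × m ≡ K + total ts
  ∈ps⁻ {p} p∈ q with _ , w , s ← ∈-filter⁻ cond? {xs = boundedVecs m m} p∈
                with a , b ← ∈-withProfile⁻ K p s q = a , trans (sym w) b
  into : concatMap (withProfile K) ps ⊆ forests (m ∸ K) K
  into {ts} q with p , p∈ , r ← find (∈-concatMap⁻ (withProfile K) {ps} q) =
    ∈-forests⁺ (m ∸ K) ts (sym (trans (cong (_∸ K) (proj₂ (∈ps⁻ p∈ r))) (m+n∸m≡n K (total ts))))
  onto : forests (m ∸ K) K ⊆ concatMap (withProfile K) ps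
  onto {ts} q = ∈-concatMap⁺ (withProfile K) (lose p∈ (∈-withProfile⁺ ts (≤-reflexive weight≡)))
    where
    weight≡ : K + total ts ≡ m
    weight≡ = trans (cong (_+_ K) (∈-forests⁻ (m ∸ K) K q)) (m+[n∸m]≡n K≤m)
    sums = profile-sum {m = m} ts (≤-reflexive weight≡)
    -- The entries of a profile are at most their sum K, which is at most `m`, so the cut-off in
    -- `boundedVecs` loses no forest.
    p∈ : profile m ts ∈ ps
    p∈ = ∈-filter⁺ cond? (∈-boundedVecs (profile m ts) (≤-trans (≤-reflexive (proj₁ sums)) K≤m))
      (trans (proj₂ sums) weight≡ , proj₁ sums)

-- The left spine and the angles at the first vertex.

fromSpine : Vec Tree K → Tree
fromSpine []       = leaf
fromSpine (r ∷ rs) = node (fromSpine rs) r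

size-fromSpine : (ts : Vec Tree K) → size (fromSpine ts) ≡ K + total ts
size-fromSpine [] = refl
size-fromSpine {suc K} (r ∷ rs) = cong suc
  (trans (cong (_+ size r) (size-fromSpine rs)) (rearrange K (total rs) (size r)))
  where
  rearrange : ∀ x y z → x + y + z ≡ x + (z + y)
  rearrange = solve-∀

node-injective : ∀ {l r l′ r′} → node l r ≡ node l′ r′ → l ≡ l′ × r ≡ r′
node-injective refl = refl , refl

fromSpine-injective : {ts us : Vec Tree K} → fromSpine ts ≡ fromSpine us → ts ≡ us
fromSpine-injective {ts = []}    {[]}    eq = refl
fromSpine-injective {ts = _ ∷ _} {_ ∷ _} eq with l≡l′ , r≡r′ ← node-injective eq =
  cong₂ _∷_ r≡r′ (fromSpine-injective l≡l′)

fromSpine-surjective : ∀ t → ∃[ K ] ∃[ ts ] t ≡ fromSpine {K} ts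
fromSpine-surjective leaf = 0 , [] , refl
fromSpine-surjective (node l r) with K , ts , refl ← fromSpine-surjective l = suc K , r ∷ ts , refl

-- The counterpart of `AngleAtFirst` for triples of naturals: `fanAngle? i ∘ ψ` unfolds to
-- `angleAtFirst? i`, so `length-filter-triangles` applies to it directly.
FanAngle : ℕ → ℕ × ℕ × ℕ → Set
FanAngle i (x , y , z) = x ≡ 0 × z ∸ y ≡ i

fanAngle? : ∀ i → Decidable (FanAngle i)
fanAngle? i (x , y , z) = (x ≟ 0) ×-dec (z ∸ y ≟ i)

-- The right subtree is drawn from `end 0 l`, which is positive, so only the root and the left
-- subtree have triangles at vertex 0. The root angle is measured by the `suc (size r)` sides that
-- the right subtree spans.
fan-count : (ts : Vec Tree K) (i : Fin m) →
  length (filter (fanAngle? (suc (toℕ i))) (triples 0 (fromSpine ts))) ≡ lookup (profile m ts) i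
fan-count [] i = sym (lookup-replicate i 0)
fan-count {m = m} (r ∷ rs) i = helper (size r ≟ toℕ i)
  where
  l = fromSpine rs
  c = end 0 l
  P? = fanAngle? (suc (toℕ i))
  angle : end c r ∸ c ≡ suc (size r)
  angle = trans (cong (_∸ c) (trans (end≡ c r) (sym (+-suc c (size r))))) (m+n∸m≡n c (suc (size r)))
  right-none : filter P? (triples c r) ≡ []
  right-none = filter-none P? (ListAll.tabulate λ q (x≡0 , _) →
    <⇒≢ (<-≤-trans (a<end 0 l) (Bounds.a≤x (triple-bounds r q))) (sym x≡0))
  rest : length (filter P? (triples 0 l ++ triples c r)) ≡ lookup (profile m rs) i
  rest = trans (cong length (trans (filter-++ P? (triples 0 l) (triples c r))
                 (trans (cong (filter P? (triples 0 l) ++_) right-none) (++-identityʳ _))))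
               (fan-count rs i)
  helper : Dec (size r ≡ toℕ i) →
    length (filter P? (triples 0 (node l r))) ≡ lookup (bump (size r) (profile m rs)) i
  helper (yes eq) = trans
    (cong length (filter-accept P? {0 , c , end c r} {triples 0 l ++ triples c r}
      (refl , trans angle (cong suc eq))))
    (trans (cong suc rest) (sym (lookup-bump (profile m rs) i eq)))
  helper (no neq) = trans
    (cong length (filter-reject P? {0 , c , end c r} {triples 0 l ++ triples c r}
      λ (_ , eq) → neq (suc-injective (trans (sym angle) eq))))
    (trans rest (sym (lookup-bump-≢ (size r) (profile m rs) i neq)))

vec-ext : {k l : Vec ℕ m} → (∀ i → lookup k i ≡ lookup l i) → k ≡ l
vec-ext {k = k} {l} eq =
  trans (sym (tabulate∘lookup k)) (trans (tabulate-cong eq) (tabulate∘lookup l))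

-- Counting all triangulations and those with prescribed angles.

module Counting {n m : ℕ} (n≡3+m : n ≡ 3 + m) where

  open Polygon n
  open Encoding n≡3+m

  n∸2≡1+m : n ∸ 2 ≡ suc m
  n∸2≡1+m = cong (_∸ 2) n≡3+m

  length-triangulations : length triangulations ≡ catalan (n ∸ 2)
  length-triangulations = begin
    length triangulations
      ≡⟨ unique-set-length triangulations-unique
           (unique-map⁺-∈ (λ p q → encode-injective (size≡ p) (size≡ q)) (trees-unique (suc m)))
           into onto ⟩
    length (map encode (trees (suc m))) ≡⟨ length-map encode (trees (suc m)) ⟩
    length (trees (suc m))             ≡⟨ length-trees (suc m) ⟩
    catalan (suc m)                    ≡⟨ cong catalan n∸2≡1+m ⟨
    catalan (n ∸ 2)                    ∎
    where
    open ≡-Reasoning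
    size≡ : ∀ {t} → t ∈ trees (suc m) → size t ≡ suc m
    size≡ = ∈-trees⁻ (suc m)
    into : triangulations ⊆ map encode (trees (suc m))
    into T∈ with t , eq , refl ← decoded T∈ = ∈-map⁺ encode (∈-trees⁺ (suc m) eq)
    onto : map encode (trees (suc m)) ⊆ triangulations
    onto q with t , t∈ , refl ← ∈-map⁻ encode q = encode-∈-triangulations (size≡ t∈)

  angles : ∀ {K} (ts : Vec Tree K) → size (fromSpine ts) ≡ suc m → ∀ (i : Fin (n ∸ 2)) →
           𝒜 (suc (toℕ i)) (encode (fromSpine ts)) ≡ lookup (profile (n ∸ 2) ts) i
  angles ts eq i = trans (length-filter-triangles eq (fanAngle? (suc (toℕ i)))) (fan-count ts i)

  length-anglesAre : ∀ k → weightedSum k ≡ n ∸ 2 →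
    length (filter (anglesAre? k) triangulations) ≡ multinomial (sum k) k * catalanProduct k
  length-anglesAre k weight = begin
    length (filter (anglesAre? k) triangulations)
      ≡⟨ unique-set-length (Unique.filter⁺ (anglesAre? k) triangulations-unique)
           (unique-map⁺-∈ (λ p q eq → fromSpine-injective (encode-injective (size≡ p) (size≡ q) eq))
             (withProfile-unique (sum k) k)) into onto ⟩
    length (map (encode ∘ fromSpine) (withProfile (sum k) k))
      ≡⟨ length-map (encode ∘ fromSpine) (withProfile (sum k) k) ⟩
    length (withProfile (sum k) k)
      ≡⟨ length-withProfile (sum k) k refl ⟩
    multinomial (sum k) k * catalanProduct k ∎
    where
    open ≡-Reasoning
    size≡ : ∀ {ts} → ts ∈ withProfile (sum k) k → size (fromSpine ts) ≡ suc m
    size≡ {ts} q = trans (size-fromSpine ts)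
      (trans (sym (proj₂ (∈-withProfile⁻ (sum k) k refl q))) (trans weight n∸2≡1+m))
    ∈-withProfile : ∀ {K} (ts : Vec Tree K) → size (fromSpine ts) ≡ suc m →
      (∀ i → lookup (profile (n ∸ 2) ts) i ≡ lookup k i) →
      encode (fromSpine ts) ∈ map (encode ∘ fromSpine) (withProfile (sum k) k)
    ∈-withProfile {K} ts size≡ eq = helper (vec-ext eq)
      where
      fits : K + total ts ≤ n ∸ 2
      fits = ≤-reflexive (trans (sym (size-fromSpine ts)) (trans size≡ (sym n∸2≡1+m)))
      helper : profile (n ∸ 2) ts ≡ k →
               encode (fromSpine ts) ∈ map (encode ∘ fromSpine) (withProfile (sum k) k)
      -- The length `K` of the spine was read off the tree; it equals `sum k` because the entries of
      -- a profile add up to the number of trees.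
      helper refl = subst (λ j → encode (fromSpine ts) ∈ map (encode ∘ fromSpine) (withProfile j k))
        (sym (proj₁ (profile-sum ts fits))) (∈-map⁺ (encode ∘ fromSpine) (∈-withProfile⁺ ts fits))
    into : filter (anglesAre? k) triangulations ⊆ map (encode ∘ fromSpine) (withProfile (sum k) k)
    into q
      with T∈ , are ← ∈-filter⁻ (anglesAre? k) {xs = triangulations} q
      with t , size≡ , refl ← decoded T∈
      with _ , ts , refl ← fromSpine-surjective t =
      ∈-withProfile ts size≡ λ i → trans (sym (angles ts size≡ i)) (are i)
    onto : map (encode ∘ fromSpine) (withProfile (sum k) k) ⊆ filter (anglesAre? k) triangulations
    onto q with ts , ts∈ , refl ← ∈-map⁻ (encode ∘ fromSpine) q =
      ∈-filter⁺ (anglesAre? k) (encode-∈-triangulations (size≡ ts∈)) λ i →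
        trans (angles ts (size≡ ts∈) i)
              (cong (λ p → lookup p i) (proj₁ (∈-withProfile⁻ (sum k) k refl ts∈)))

-- Nonzero denominators and the passage to rationals.

length-forests-nonZero : ∀ j k → NonZero (length (forests j (suc k)))
length-forests-nonZero j k =
  m*n≢0⇒m≢0 F {{m*n≢0⇒m≢0 (F * (j + suc k) !) {{nonZero}}}}
  where
  F = length (forests j (suc k))
  nonZero : NonZero (F * (j + suc k) ! * j !)
  nonZero = subst NonZero (sym (length-forests j k))
    (m*n≢0 (suc k) ((j + j + k) !) {{_}} {{(j + j + k) !≢0}})

sum≤weightedSum : (k : Vec ℕ m) → sum k ≤ weightedSum k
sum≤weightedSum = go suc λ i → s≤s z≤n
  where
  go : ∀ {m} (g : ℕ → ℕ) → (∀ i → 1 ≤ g i) → (k : Vec ℕ m) →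
       sum k ≤ sum (Vec.tabulate λ i → g (toℕ i) * lookup k i)
  go g 1≤g []      = z≤n
  go g 1≤g (x ∷ k) = +-mono-≤
    (≤-trans (≤-reflexive (sym (*-identityˡ x))) (*-monoˡ-≤ x (1≤g 0)))
    (go (g ∘ suc) (1≤g ∘ suc) k)

sum-positive : (k : Vec ℕ m) → 0 < weightedSum k → 0 < sum k
sum-positive {m} k pos = n≢0⇒n>0 λ eq → <⇒≢ pos
  (sym (trans (cong weightedSum (sum≡0⇒zeros k eq)) (weighted-zeros suc m)))

-- Normalised fractions hide their numerators behind a gcd. Between unnormalised ones the equation
-- is the cross-multiplied hypothesis, and `toℚᵘ` is injective up to equivalence.
ratio-* : ∀ c d a D b .{{_ : NonZero d}} .{{_ : NonZero D}} → c * D ≡ a * b * d →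
          + c ℚ./ d ≡ (+ a ℚ./ D) ℚ.* (+ b ℚ./ 1)
ratio-* c (suc d) a (suc D) b eq = ℚ.toℚᵘ-injective (begin
  ℚ.toℚᵘ (ℚ.fromℚᵘ x)                              ≈⟨ ℚ.toℚᵘ-fromℚᵘ x ⟩
  x                                                ≈⟨ ℚᵘ.*≡* x≃yz ⟩
  y ℚᵘ.* z                                         ≈⟨ ℚᵘ.*-cong (ℚ.toℚᵘ-fromℚᵘ y) (ℚ.toℚᵘ-fromℚᵘ z) ⟨
  ℚ.toℚᵘ (ℚ.fromℚᵘ y) ℚᵘ.* ℚ.toℚᵘ (ℚ.fromℚᵘ z)     ≈⟨ ℚ.toℚᵘ-homo-* (ℚ.fromℚᵘ y) (ℚ.fromℚᵘ z) ⟨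
  ℚ.toℚᵘ (ℚ.fromℚᵘ y ℚ.* ℚ.fromℚᵘ z)               ∎)
  where
  open ℚᵘ.≃-Reasoning
  x = ℚᵘ.mkℚᵘ (+ c) d
  y = ℚᵘ.mkℚᵘ (+ a) D
  z = ℚᵘ.mkℚᵘ (+ b) 0
  x≃yz : + c ℤ.* + (suc D * 1) ≡ (+ a ℤ.* + b) ℤ.* + suc d
  x≃yz = trans (sym (ℤ.pos-* c (suc D * 1)))
    (trans (cong +_ (trans (cong (c *_) (*-identityʳ (suc D))) eq))
    (trans (ℤ.pos-* (a * b) (suc d)) (cong (ℤ._* + suc d) (ℤ.pos-* a b))))

Z-formula : ∀ m K → 0 < K → K ≤ m →
  NonZero (Z (2 + m) K) × Z (2 + m) K * (m ∸ K) ! * m ! ≡ K * (2 * (2 + m) ∸ K ∸ 5) !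
Z-formula m K 0<K K≤m = go K (m ∸ K) 0<K (m∸n+n≡m K≤m) (Z≡length-forests m K≤m)
  where
  regroup : ∀ x y z → x * y * z ≡ x * z * y
  regroup = solve-∀
  -- With n = 2 + j + K and K = k + 1, this is 2n - K - 5 = 2j + K - 1; neither subtraction is
  -- truncated.
  exponent : ∀ j k → 2 * (2 + (j + suc k)) ∸ suc k ∸ 5 ≡ j + j + k
  exponent j k = trans (cong (λ u → u ∸ suc k ∸ 5) (rearrange j k))
    (cong (_∸ 5) (m+n∸m≡n (suc k) (5 + (j + j + k))))
    where
    rearrange : ∀ j k → 2 * (2 + (j + suc k)) ≡ suc k + (5 + (j + j + k))
    rearrange = solve-∀
  -- With `j` for `m ∸ K` and `z` for the value of `Z`, matching on `refl` makes `m` a sum and `z` a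
  -- length, the form of `length-forests`.
  go : ∀ {m z} K j → 0 < K → j + K ≡ m → z ≡ length (forests j K) →
       NonZero z × z * j ! * m ! ≡ K * (2 * (2 + m) ∸ K ∸ 5) !
  go (suc k) j _ refl refl = length-forests-nonZero j k , (begin
    F * j ! * (j + suc k) !    ≡⟨ regroup F (j !) ((j + suc k) !) ⟩
    F * (j + suc k) ! * j !    ≡⟨ length-forests j k ⟩
    suc k * (j + j + k) !      ≡⟨ cong (λ u → suc k * u !) (exponent j k) ⟨
    suc k * (2 * (2 + (j + suc k)) ∸ suc k ∸ 5) ! ∎)
    where
    open ≡-Reasoning
    F = length (forests j (suc k))

catalan-nonZero : ∀ m → NonZero (catalan m)
catalan-nonZero m = subst NonZero (trans (sym (length-map Vec.head (forests m 1))) (length-trees m))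
  (length-forests-nonZero m 0)

theorem6 : (n : ℕ) → 3 ≤ n →
    (k : Vec ℕ (n ∸ 2)) → All (_≤ n ∸ 2) k → weightedSum k ≡ n ∸ 2 →
    let open Polygon n
        K = sum k
        denominator = Z n K * catalan (n ∸ 2) * (n ∸ K ∸ 2) ! * (n ∸ 2) !
    in
    Σ[ nz₁ ∈ NonZero (length triangulations) ]
    Σ[ nz₂ ∈ NonZero denominator ]
      uniform triangulations {{nz₁}} (anglesAre? k)
        ≡ (ℚ._/_ (+ (K * (2 * n ∸ K ∸ 5) !)) denominator {{nz₂}})
          ℚ.* (+ (multinomial K k * catalanProduct k) ℚ./ 1)
theorem6 n 3≤n k _ weight = nz₁ , nz₂ ,
  ratio-* hits (length triangulations) (deg * (2 * n ∸ deg ∸ 5) !) denom coeff {{nz₁}} {{nz₂}} cross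
  where
  open Polygon n
  n≡ : n ≡ 3 + (n ∸ 3)
  n≡ = sym (m+[n∸m]≡n 3≤n)
  open Counting n≡
  deg = sum k
  hits = length (filter (anglesAre? k) triangulations)
  coeff = multinomial deg k * catalanProduct k
  denom = Z n deg * catalan (n ∸ 2) * (n ∸ deg ∸ 2) ! * (n ∸ 2) !
  n≡2+ : 2 + (n ∸ 2) ≡ n
  n≡2+ = m+[n∸m]≡n (≤-trans (n≤1+n 2) 3≤n)
  n∸2∸deg≡ : n ∸ 2 ∸ deg ≡ n ∸ deg ∸ 2
  n∸2∸deg≡ = trans (∸-+-assoc n 2 deg)
    (trans (cong (n ∸_) (+-comm 2 deg)) (sym (∸-+-assoc n deg 2)))
  deg≤n∸2 : deg ≤ n ∸ 2
  deg≤n∸2 = ≤-trans (sum≤weightedSum k) (≤-reflexive weight)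
  0<deg : 0 < deg
  0<deg = sum-positive k (subst (0 <_) (sym weight) (∸-monoˡ-≤ 2 3≤n))
  zf : NonZero (Z n deg) × Z n deg * (n ∸ deg ∸ 2) ! * (n ∸ 2) ! ≡ deg * (2 * n ∸ deg ∸ 5) !
  zf = subst₂ (λ a b → NonZero (Z a deg) × Z a deg * b ! * (n ∸ 2) ! ≡ deg * (2 * a ∸ deg ∸ 5) !)
    n≡2+ n∸2∸deg≡ (Z-formula (n ∸ 2) deg 0<deg deg≤n∸2)
  nz₁ : NonZero (length triangulations)
  nz₁ = subst NonZero (sym length-triangulations) (catalan-nonZero (n ∸ 2))
  nz₂ : NonZero denom
  nz₂ = m*n≢0 _ _
    {{m*n≢0 _ _ {{m*n≢0 _ _ {{proj₁ zf}} {{catalan-nonZero (n ∸ 2)}}}} {{(n ∸ deg ∸ 2) !≢0}}}}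
    {{(n ∸ 2) !≢0}}
  regroup : ∀ b z c f g → b * (z * c * f * g) ≡ z * f * g * b * c
  regroup = solve-∀
  -- The factors of the denominator other than the Catalan number multiply to K (2n - K - 5)!, and
  -- the Catalan number is the size of the sample space.
  cross : hits * denom ≡ deg * (2 * n ∸ deg ∸ 5) ! * coeff * length triangulations
  cross = begin
    hits * denom
      ≡⟨ cong (_* denom) (length-anglesAre k weight) ⟩
    coeff * denom
      ≡⟨ regroup coeff (Z n deg) (catalan (n ∸ 2)) ((n ∸ deg ∸ 2) !) ((n ∸ 2) !) ⟩
    Z n deg * (n ∸ deg ∸ 2) ! * (n ∸ 2) ! * coeff * catalan (n ∸ 2)
      ≡⟨ cong₂ (λ u v → u * coeff * v) (proj₂ zf) (sym length-triangulations) ⟩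
    deg * (2 * n ∸ deg ∸ 5) ! * coeff * length triangulations ∎
    where open ≡-Reasoning
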